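{- Let $\kappa\ge\Delta\ge 2$. Let $F_t$ be the rooted forest after $t$ updates of a fixed (oblivious) update sequence in the rooted-forest model, starting from the empty forest, and let $C_t$ be the random coloring maintained by rooted {\textsc{DistMaint}}. Then for every $t\ge 0$, $C_t$ is distributed exactly as $\mathcal D(F_t)$.
   Context: Rooted-forest model: each tree on a fixed vertex set has an assigned root (initially no edges, every vertex a root); an insertion $(p,r)$ requires $r$ to be a root and makes $r$ a child of $p$; deleting $(p,r)$, $p$ the parent of $r$, makes $r$ a root. Maximum degree stays at most $\Delta$. Palette $[\kappa]$; $A(x)$ = colors not used on edges at $x$. Distribution: a uniform coloring from a set $S\subseteq[\kappa]$ of the $\ell$ child edges of $v$ is a uniformly random injective map from the children of $v$ to $S$. For a rooted tree $T$ with root $r$ and color $\alpha$, $\mathcal D_\alpha(T)$: uniformly color the child edges of $r$ from $[\kappa]\setminus\{\alpha\}$, then independently for each child $u$ sample the coloring of the subtree $T_u$ (of $u$ and its descendants) from $\mathcal D_{\mathrm{color}(r,u)}(T_u)$. $\mathcal D(T)$ is the same except the root's child edges are uniformly colored from $[\kappa]$. $\mathcal D(F)$ samples each tree of $F$ independently from $\mathcal D(T)$. Rooted {\textsc{DistMaint}}: FixForbidden$(v,\alpha,\beta)$: if no child edge of $v$ has color $\beta$ stop; else recolor that child edge $(v,w)$ to $\alpha$ and call FixForbidden$(w,\beta,\alpha)$. Insertion $(p,r)$: choose $\beta$ uniformly from $A(p)$, color $(p,r)$ by $\beta$; if no child edge of $r$ has color $\beta$ stop, else for that edge $(r,w)$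 choose $\alpha$ uniformly from $A(r)$, recolor $(r,w)$ to $\alpha$ and call FixForbidden$(w,\beta,\alpha)$. Deletion of $(p,r)$ with color $\alpha$: delete it; with $\ell$ the number of children of $r$, with probability $(\kappa-\ell)/\kappa$ stop; otherwise pick a uniformly random child $w$, let $\beta=\mathrm{color}(r,w)$, recolor $(r,w)$ to $\alpha$ and call FixForbidden$(w,\beta,\alpha)$. Random choices independent. -}

module Defs where

open import Data.Bool using (Bool; true; false; not; if_then_else_; _∨_)
open import Data.Nat using (ℕ; zero; suc; _+_; _≤_; _∸_)
open import Data.Fin using (Fin)
open import Data.Fin.Properties using () renaming (_≟_ to _≟F_)
open import Data.Maybe using (Maybe; just; nothing)
import Data.Maybe.Properties as MP
import Data.Vec.Properties as VP
open import Data.Vec using (Vec; lookup; replicate; _[_]≔_)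
open import Data.List using (List; []; _∷_; map; concatMap; length; filterᵇ; allFin; head; zip; foldl; take)
open import Data.Bool.ListAction using (any)
open import Data.Product using (_×_; _,_)
open import Data.Unit using (⊤)
open import Data.Integer using (+_)
open import Data.Rational using (ℚ; 0ℚ; 1ℚ; _/_; _*_) renaming (_+_ to _+ℚ_)
open import Relation.Nullary using (does)
open import Relation.Binary.PropositionalEquality using (_≡_)
open import Relation.Binary.Definitions using (DecidableEquality)

Dist : Set → Set
Dist A = List (A × ℚ)

return : {A : Set} → A → Dist A
return a = (a , 1ℚ) ∷ []

_>>=_ : {A B : Set} → Dist A → (A → Dist B) → Dist B
d >>= f = concatMap (λ { (a , p) → map (λ { (b , q) → (b , p * q) }) (f a) }) d

scale : {A : Set} → ℚ → Dist A → Dist A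
scale r = map (λ { (a , p) → (a , r * p) })

-- uniform distribution on the entries of a list (empty list: no mass;
-- never used in valid runs)
uniform : {A : Set} → List A → Dist A
uniform [] = []
uniform (x ∷ xs) = map (λ a → (a , (+ 1) / suc (length xs))) (x ∷ xs)

-- a / d as a rational (d = 0 never used: κ ≥ 2)
frac : ℕ → ℕ → ℚ
frac a zero = 0ℚ
frac a (suc d) = (+ a) / suc d

prob : {A : Set} → DecidableEquality A → Dist A → A → ℚ
prob _≟_ [] x = 0ℚ
prob _≟_ ((a , p) ∷ d) x = (if does (a ≟ x) then p else 0ℚ) +ℚ prob _≟_ d x

-- parent of each vertex (nothing = the vertex is a root)
Forest : ℕ → Set
Forest n = Vec (Maybe (Fin n)) n

-- colour of the edge (parent v, v) stored at v (nothing for roots)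
Coloring : ℕ → ℕ → Set
Coloring n κ = Vec (Maybe (Fin κ)) n

_≟C_ : {n κ : ℕ} → DecidableEquality (Coloring n κ)
_≟C_ = VP.≡-dec (MP.≡-dec _≟F_)

emptyF : {n : ℕ} → Forest n
emptyF = replicate _ nothing

emptyC : {n κ : ℕ} → Coloring n κ
emptyC = replicate _ nothing

_==_ : {m : ℕ} → Fin m → Fin m → Bool
a == b = does (a ≟F b)

isParent : {n : ℕ} → Forest n → Fin n → Fin n → Bool
isParent F v w with lookup F w
... | nothing = false
... | just u = u == v

children : {n : ℕ} → Forest n → Fin n → List (Fin n)
children {n} F v = filterᵇ (isParent F v) (allFin n)

isRoot : {n : ℕ} → Forest n → Fin n → Bool
isRoot F v with lookup F v
... | nothing = true
... | just _ = false

roots : {n : ℕ} → Forest n → List (Fin n)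
roots {n} F = filterᵇ (isRoot F) (allFin n)

deg : {n : ℕ} → Forest n → Fin n → ℕ
deg F v = length (children F v) + (if isRoot F v then 0 else 1)

hasColor : {n κ : ℕ} → Coloring n κ → Fin κ → Fin n → Bool
hasColor c β w with lookup c w
... | nothing = false
... | just a = a == β

childWithColor : {n κ : ℕ} → Forest n → Coloring n κ → Fin n → Fin κ → Maybe (Fin n)
childWithColor F c v β = head (filterᵇ (hasColor c β) (children F v))

usedAt : {n κ : ℕ} → Forest n → Coloring n κ → Fin n → List (Maybe (Fin κ))
usedAt F c x = (if isRoot F x then nothing else lookup c x) ∷ map (lookup c) (children F x)

isJust= : {κ : ℕ} → Fin κ → Maybe (Fin κ) → Bool
isJust= a nothing = false
isJust= a (just b) = a == b

avail : {n κ : ℕ} → Forest n → Coloring n κ → Fin n → List (Fin κ)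
avail {κ = κ} F c x = filterᵇ (λ a → not (any (isJust= a) (usedAt F c x))) (allFin κ)

-- is a an ancestor of x or x itself (fuel = number of vertices)
ancOrSelf : {n : ℕ} → ℕ → Forest n → Fin n → Fin n → Bool
ancOrSelf zero F a x = false
ancOrSelf (suc k) F a x with a == x | lookup F x
... | true | _ = true
... | false | nothing = false
... | false | just y = ancOrSelf k F a y

data Update (n : ℕ) : Set where
  ins : Fin n → Fin n → Update n
  del : Fin n → Fin n → Update n

applyU : {n : ℕ} → Forest n → Update n → Forest n
applyU F (ins p r) = F [ r ]≔ just p
applyU F (del p r) = F [ r ]≔ nothing

Legal : {n : ℕ} → Forest n → Update n → Set
Legal {n} F (ins p r) = (lookup F r ≡ nothing) × (ancOrSelf n F r p ≡ false)
Legal F (del p r) = lookup F r ≡ just p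

ValidFrom : {n : ℕ} → ℕ → Forest n → List (Update n) → Set
ValidFrom Δ F [] = ⊤
ValidFrom Δ F (u ∷ us) =
  Legal F u × ((v : _) → deg (applyU F u) v ≤ Δ) × ValidFrom Δ (applyU F u) us

runF : {n : ℕ} → Forest n → List (Update n) → Forest n
runF = foldl applyU

picks : {A : Set} → List A → List (A × List A)
picks [] = []
picks (x ∷ xs) = (x , xs) ∷ map (λ { (y , r) → (y , x ∷ r) }) (picks xs)

arrangements : {A : Set} → List A → ℕ → List (List A)
arrangements S zero = [] ∷ []
arrangements S (suc k) =
  concatMap (λ { (x , rest) → map (x ∷_) (arrangements rest k) }) (picks S)

allowed : {κ : ℕ} → Maybe (Fin κ) → List (Fin κ)
allowed {κ} f = filterᵇ (λ a → not (isJust= a f)) (allFin κ)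

-- colour the subtree below v: child edges of v uniformly (injectively) from
-- [κ] \ {f} (f = nothing: from [κ]), then recurse independently.
-- fuel bounds the depth (n suffices).
mutual
  sampleBelow : {n κ : ℕ} → ℕ → Forest n → Fin n → Maybe (Fin κ) → Coloring n κ → Dist (Coloring n κ)
  sampleBelow zero F v f c = return c
  sampleBelow (suc k) F v f c =
    uniform (arrangements (allowed f) (length (children F v))) >>= λ cols →
    sampleList k F (zip (children F v) cols) c

  sampleList : {n κ : ℕ} → ℕ → Forest n → List (Fin n × Fin κ) → Coloring n κ → Dist (Coloring n κ)
  sampleList k F [] c = return c
  sampleList k F ((w , a) ∷ rest) c =
    sampleBelow k F w (just a) (c [ w ]≔ just a) >>= sampleList k F rest

DF : {n κ : ℕ} → Forest n → Dist (Coloring n κ)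
DF {n} F = foldl (λ d v → d >>= sampleBelow n F v nothing) (return emptyC) (roots F)

-- FixForbidden(v, α, β); fuel bounds the depth
fixForbidden : {n κ : ℕ} → ℕ → Forest n → Fin n → Fin κ → Fin κ → Coloring n κ → Dist (Coloring n κ)
fixForbidden zero F v α β c = return c
fixForbidden (suc k) F v α β c with childWithColor F c v β
... | nothing = return c
... | just w = fixForbidden k F w β α (c [ w ]≔ just α)

step : {n κ : ℕ} → Forest n → Update n → Coloring n κ → Dist (Coloring n κ)
step {n} F (ins p r) c =
  uniform (avail F c p) >>= λ β → insRest β (c [ r ]≔ just β)
  where
  F' = applyU F (ins p r)
  insRest : _ → _ → _
  insRest β c1 with childWithColor F' c1 r β
  ... | nothing = return c1
  ... | just w = uniform (avail F' c1 r) >>= λ α →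
                 fixForbidden n F' w β α (c1 [ w ]≔ just α)
step {n} {κ} F (del p r) c with lookup c r
... | nothing = return c
... | just α =
  (c1 , frac (κ ∸ length (children F' r)) κ)
    ∷ concatMap (λ w → scale (frac 1 κ) (recol w (lookup c1 w))) (children F' r)
  where
  F' = applyU F (del p r)
  c1 = c [ r ]≔ nothing
  recol : Fin n → Maybe (Fin κ) → Dist (Coloring n κ)
  recol w nothing = return c1
  recol w (just β) = fixForbidden n F' w β α (c1 [ w ]≔ just α)

runC : {n κ : ℕ} → Forest n → Dist (Coloring n κ) → List (Update n) → Dist (Coloring n κ)
runC F d [] = d
runC F d (u ∷ us) = runC (applyU F u) (d >>= step F u) us

{-# OPTIONS --safe #-}

-- 𝓓(F) gives the same weight to every proper edge colouring of F, because the number of choices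
-- at a vertex depends only on its degree; so it suffices that each update maps the uniform
-- distribution on proper colourings of F to the one for the updated forest.  Insertion and
-- deletion of (p , r) are reverse to each other: exchanging two colours along a descending
-- bichromatic path is an involution, and the two transition probabilities have a constant ratio.
-- Summing over all sources, every proper colouring receives the same mass.

module Submission where

open import Defs
open import Data.Bool using (Bool; true; false; not; T; if_then_else_; _∨_; _∧_)
open import Data.Bool.ListAction using (any)
open import Data.Bool.Properties using (T-≡; ∨-identityʳ; ∨-zeroʳ; ∨-assoc; ∨-comm)
open import Data.Empty using (⊥-elim)
open import Data.Fin using (Fin)
open import Data.Fin.Properties using () renaming (_≟_ to _≟F_)
open import Data.Integer using (+_)
import Data.Integer as ℤ
import Data.Integer.Properties as ℤ
open import Data.List using (List; []; _∷_; map; length; filter; filterᵇ; allFin; concat; concatMap; zip; foldl; head; take; catMaybes; _++_)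
open import Data.List.Membership.Propositional using (_∈_; _∉_; find; lose)
import Data.List.Membership.DecPropositional as DecMembership
open import Data.List.Membership.Propositional.Properties using (∈-map⁺; ∈-map⁻; ∈-concatMap⁺; ∈-concatMap⁻; ∈-filter⁺; ∈-filter⁻; ∈-allFin)
open import Data.List.Properties using (map-++; map-∘; map-id; map-cong; map-injective; map-concatMap; ∷-injective; length-map; length-++; length-tabulate; filter-all; filter-≐; filter-notAll; concatMap-cong)
open import Data.List.Relation.Unary.All as All using (All; []; _∷_)
import Data.List.Relation.Unary.All.Properties as AllP
open import Data.List.Relation.Unary.AllPairs using ([]; _∷_)
open import Data.List.Relation.Unary.Any using (here; there)
import Data.List.Relation.Unary.Any.Properties as AnyP
open import Data.List.Relation.Unary.Unique.Propositional using (Unique)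
import Data.List.Relation.Unary.Unique.Propositional.Properties as UP
open import Data.Maybe using (Maybe; just; nothing)
open import Data.Maybe.Properties using (just-injective; ≡-dec)
open import Data.Nat using (ℕ; zero; suc; pred; _+_; _∸_; _≤_; _<_; z≤n; s≤s; s≤s⁻¹; _<?_) renaming (_*_ to _*ℕ_)
import Data.Nat.Properties as ℕ
open import Data.Product using (Σ; ∃-syntax; _×_; _,_; proj₁; proj₂)
open import Data.Rational using (ℚ; 0ℚ; 1ℚ; _*_; fromℚᵘ) renaming (_+_ to _+ℚ_)
import Data.Rational.Properties as ℚ
open import Data.Rational.Solver using (module +-*-Solver)
open import Data.Rational.Unnormalised using (mkℚᵘ; *≡*)
import Data.Rational.Unnormalised as ℚᵘ
import Data.Rational.Unnormalised.Properties as ℚᵘ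
open import Data.Sum using (_⊎_; inj₁; inj₂)
open import Data.Unit using (⊤; tt)
open import Data.Vec using (Vec; lookup; tabulate; _[_]≔_)
open import Data.Vec.Properties using (lookup∘update; lookup∘update′; lookup-replicate; lookup∘tabulate; tabulate∘lookup; tabulate-cong; []≔-idempotent; []≔-lookup)
open import Function using (_∘_; _⇔_; mk⇔; Equivalence)
open import Relation.Binary.Definitions using (DecidableEquality)
open import Relation.Binary.PropositionalEquality
open import Relation.Nullary using (¬_; Dec; yes; no; does)
open import Relation.Nullary.Decidable using (dec-true; dec-false; T?)

open ≡-Reasoning

-- The constant ratio is what the coin in the deletion is made for. Let `a` be the number of colours
-- free at `p` before the insertion, and let `b` be κ minus the number of children of `r`. An
-- insertion without conflict has probability 1/a and is reversed by the deletion that stops, of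
-- probability b/κ. An insertion with an exchange has probability 1/(ab) and is reversed by the
-- choice of one child, of probability 1/κ. Both quotients are κ/(ab). The degree bound makes `a`
-- and `b` positive. Proper colourings are never counted: equal weights on a duplicate-free support
-- with total mass 1 already pin down the weight. The obstacle is that the colouring is improper
-- while an exchange is under way. The whole path is therefore described at once, by a vertex set
-- whose growth rule only asks whether a colour belongs to the exchanged pair; this description can
-- be read in both directions. Fuel is controlled by ranks that increase from parent to child and
-- stay below the number of vertices.

private
  variable
    A B : Set
    n κ : ℕ

-- Finite sums

sumOf : List A → (A → ℚ) → ℚ
sumOf []       g = 0ℚ
sumOf (x ∷ xs) g = g x +ℚ sumOf xs g

sum-cong : (xs : List A) {g g′ : A → ℚ} → (∀ {x} → x ∈ xs → g x ≡ g′ x) → sumOf xs g ≡ sumOf xs g′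
sum-cong []       eq = refl
sum-cong (x ∷ xs) eq = cong₂ _+ℚ_ (eq (here refl)) (sum-cong xs (eq ∘ there))

sum-zero : (xs : List A) {g : A → ℚ} → (∀ {x} → x ∈ xs → g x ≡ 0ℚ) → sumOf xs g ≡ 0ℚ
sum-zero []       eq = refl
sum-zero (x ∷ xs) eq = trans (cong₂ _+ℚ_ (eq (here refl)) (sum-zero xs (eq ∘ there))) (ℚ.+-identityˡ 0ℚ)

sum-++ : (xs ys : List A) (g : A → ℚ) → sumOf (xs ++ ys) g ≡ sumOf xs g +ℚ sumOf ys g
sum-++ []       ys g = sym (ℚ.+-identityˡ _)
sum-++ (x ∷ xs) ys g = trans (cong (g x +ℚ_) (sum-++ xs ys g)) (sym (ℚ.+-assoc (g x) _ _))

sum-map : (f : A → B) (xs : List A) (g : B → ℚ) → sumOf (map f xs) g ≡ sumOf xs (g ∘ f)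
sum-map f []       g = refl
sum-map f (x ∷ xs) g = cong (g (f x) +ℚ_) (sum-map f xs g)

sum-concatMap : (f : A → List B) (xs : List A) (g : B → ℚ) →
  sumOf (concatMap f xs) g ≡ sumOf xs (λ x → sumOf (f x) g)
sum-concatMap f []       g = refl
sum-concatMap f (x ∷ xs) g =
  trans (sum-++ (f x) (concatMap f xs) g) (cong (sumOf (f x) g +ℚ_) (sum-concatMap f xs g))

sum-*ˡ : (k : ℚ) (xs : List A) (g : A → ℚ) → sumOf xs (λ x → k * g x) ≡ k * sumOf xs g
sum-*ˡ k []       g = sym (ℚ.*-zeroʳ k)
sum-*ˡ k (x ∷ xs) g = trans (cong (k * g x +ℚ_) (sum-*ˡ k xs g)) (sym (ℚ.*-distribˡ-+ k (g x) _))

sum-*ʳ : (k : ℚ) (xs : List A) (g : A → ℚ) → sumOf xs (λ x → g x * k) ≡ sumOf xs g * k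
sum-*ʳ k xs g = trans (sum-cong xs (λ {x} _ → ℚ.*-comm (g x) k)) (trans (sum-*ˡ k xs g) (ℚ.*-comm k _))

sum-+ : (xs : List A) (g g′ : A → ℚ) → sumOf xs (λ x → g x +ℚ g′ x) ≡ sumOf xs g +ℚ sumOf xs g′
sum-+ []       g g′ = refl
sum-+ (x ∷ xs) g g′ = trans (cong (g x +ℚ g′ x +ℚ_) (sum-+ xs g g′))
  (solve 4 (λ a b c d → (a :+ b) :+ (c :+ d) := (a :+ c) :+ (b :+ d)) refl (g x) (g′ x) (sumOf xs g) (sumOf xs g′))
  where open +-*-Solver

sum-swap : (xs : List A) (ys : List B) (g : A → B → ℚ) →
  sumOf xs (λ x → sumOf ys (g x)) ≡ sumOf ys (λ y → sumOf xs (λ x → g x y))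
sum-swap []       ys g = sym (sum-zero ys (λ _ → refl))
sum-swap (x ∷ xs) ys g = trans (cong (sumOf ys (g x) +ℚ_) (sum-swap xs ys g)) (sym (sum-+ ys (g x) _))

sum-single : {xs : List A} {a : A} → Unique xs → a ∈ xs → (g : A → ℚ) →
  (∀ {x} → x ∈ xs → x ≢ a → g x ≡ 0ℚ) → sumOf xs g ≡ g a
sum-single (fresh ∷ _) (here refl) g z =
  trans (cong (g _ +ℚ_) (sum-zero _ (λ m → z (there m) (≢-sym (All.lookup fresh m))))) (ℚ.+-identityʳ _)
sum-single (fresh ∷ u) (there m) g z =
  trans (cong₂ _+ℚ_ (z (here refl) (All.lookup fresh m)) (sum-single u m g (z ∘ there))) (ℚ.+-identityˡ _)

-- Arithmetic of `frac`

fromℚᵘ-+ : ∀ p q → fromℚᵘ p +ℚ fromℚᵘ q ≡ fromℚᵘ (p ℚᵘ.+ q)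
fromℚᵘ-+ p q = ℚ.toℚᵘ-injective (ℚᵘ.≃-trans (ℚ.toℚᵘ-homo-+ (fromℚᵘ p) (fromℚᵘ q))
  (ℚᵘ.≃-trans (ℚᵘ.+-cong (ℚ.toℚᵘ-fromℚᵘ p) (ℚ.toℚᵘ-fromℚᵘ q)) (ℚᵘ.≃-sym (ℚ.toℚᵘ-fromℚᵘ (p ℚᵘ.+ q)))))

fromℚᵘ-* : ∀ p q → fromℚᵘ p * fromℚᵘ q ≡ fromℚᵘ (p ℚᵘ.* q)
fromℚᵘ-* p q = ℚ.toℚᵘ-injective (ℚᵘ.≃-trans (ℚ.toℚᵘ-homo-* (fromℚᵘ p) (fromℚᵘ q))
  (ℚᵘ.≃-trans (ℚᵘ.*-cong (ℚ.toℚᵘ-fromℚᵘ p) (ℚ.toℚᵘ-fromℚᵘ q)) (ℚᵘ.≃-sym (ℚ.toℚᵘ-fromℚᵘ (p ℚᵘ.* q)))))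

ι : ℕ → ℚ
ι m = frac m 1

ι-+ : ∀ a b → ι (a + b) ≡ ι a +ℚ ι b
ι-+ a b = trans
  (ℚ.fromℚᵘ-cong {mkℚᵘ (+ (a + b)) 0} {mkℚᵘ (+ a) 0 ℚᵘ.+ mkℚᵘ (+ b) 0}
    (*≡* (cong (ℤ._* + 1) (sym (cong₂ ℤ._+_ (ℤ.*-identityʳ (+ a)) (ℤ.*-identityʳ (+ b)))))))
  (sym (fromℚᵘ-+ (mkℚᵘ (+ a) 0) (mkℚᵘ (+ b) 0)))

-- Separates numerator and denominator, so that the ring solver can treat `ι a` and `frac 1 d` as
-- atoms. The default value at `d = 0` is consistent with this: both sides vanish.
frac-split : ∀ a d → frac a d ≡ ι a * frac 1 d
frac-split a zero    = sym (ℚ.*-zeroʳ (ι a))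
frac-split a (suc d) = trans
  (ℚ.fromℚᵘ-cong {mkℚᵘ (+ a) d} {mkℚᵘ (+ a) 0 ℚᵘ.* mkℚᵘ (+ 1) d}
    (*≡* (cong₂ ℤ._*_ (sym (ℤ.*-identityʳ (+ a))) (cong +_ (ℕ.*-identityˡ (suc d))))))
  (sym (fromℚᵘ-* (mkℚᵘ (+ a) 0) (mkℚᵘ (+ 1) d)))

ι-frac : ∀ {m} → 0 < m → ι m * frac 1 m ≡ 1ℚ
ι-frac {suc m} _ = trans (sym (frac-split (suc m) (suc m)))
  (ℚ.fromℚᵘ-cong {mkℚᵘ (+ suc m) m} {mkℚᵘ (+ 1) 0} (*≡* (ℤ.*-comm (+ suc m) (+ 1))))

sum-1 : (xs : List A) → sumOf xs (λ _ → 1ℚ) ≡ ι (length xs)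
sum-1 []       = refl
sum-1 (x ∷ xs) = trans (cong (1ℚ +ℚ_) (sum-1 xs)) (sym (ι-+ 1 (length xs)))

-- Expectations

E : Dist A → (A → ℚ) → ℚ
E d g = sumOf d (λ aq → proj₂ aq * g (proj₁ aq))

mass : Dist A → ℚ
mass d = E d (λ _ → 1ℚ)

supp : Dist A → List A
supp = map proj₁

-- Lists may present the same distribution in different orders or with repeated outcomes. Agreement
-- of all expectations ignores this and is preserved by `_>>=_`.
_≈_ : Dist A → Dist A → Set
d ≈ d′ = ∀ g → E d g ≡ E d′ g

E-cong : (d : Dist A) {g g′ : A → ℚ} → (∀ {a} → a ∈ supp d → g a ≡ g′ a) → E d g ≡ E d g′
E-cong d eq = sum-cong d (λ {aq} m → cong (proj₂ aq *_) (eq (∈-map⁺ proj₁ m)))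

E-*ˡ : (k : ℚ) (d : Dist A) (g : A → ℚ) → E d (λ a → k * g a) ≡ k * E d g
E-*ˡ k d g = trans
  (sum-cong d (λ {aq} _ → solve 3 (λ x y z → x :* (y :* z) := y :* (x :* z)) refl (proj₂ aq) k (g (proj₁ aq))))
  (sum-*ˡ k d _)
  where open +-*-Solver

E-zero : (d : Dist A) {g : A → ℚ} → (∀ {a} → a ∈ supp d → g a ≡ 0ℚ) → E d g ≡ 0ℚ
E-zero d z = sum-zero d (λ {aq} m → trans (cong (proj₂ aq *_) (z (∈-map⁺ proj₁ m))) (ℚ.*-zeroʳ (proj₂ aq)))

E-return : (a : A) (g : A → ℚ) → E (return a) g ≡ g a
E-return a g = trans (ℚ.+-identityʳ _) (ℚ.*-identityˡ (g a))

private
  -- The parameter `h` stands for the anonymous pattern-matching functions inside `_>>=_` and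
  -- `scale`, which are accessible only through their values on pairs.
  E-weights : (p : ℚ) (h : B × ℚ → B × ℚ) → (∀ b q → h (b , q) ≡ (b , p * q)) →
    ∀ e (g : B → ℚ) → E (map h e) g ≡ p * E e g
  E-weights p h eq e g = trans (sum-map h e _) (trans
    (sum-cong e (λ { {b , q} _ → trans (cong (λ z → proj₂ z * g (proj₁ z)) (eq b q)) (ℚ.*-assoc p q (g b)) }))
    (sum-*ˡ p e _))

  supp-weights : (p : ℚ) (h : B × ℚ → B × ℚ) → (∀ b q → h (b , q) ≡ (b , p * q)) →
    ∀ e → supp (map h e) ≡ supp e
  supp-weights p h eq []            = refl
  supp-weights p h eq ((b , q) ∷ e) = cong₂ _∷_ (cong proj₁ (eq b q)) (supp-weights p h eq e)

  All-weights : {w : ℚ} (p : ℚ) (h : B × ℚ → B × ℚ) → (∀ b q → h (b , q) ≡ (b , p * q)) →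
    ∀ {e} → All (λ bq → proj₂ bq ≡ w) e → All (λ bq → proj₂ bq ≡ p * w) (map h e)
  All-weights p h eq []                      = []
  All-weights p h eq (_∷_ {b , q} refl al) = cong proj₂ (eq b q) ∷ All-weights p h eq al

E-scale : (p : ℚ) (d : Dist A) (g : A → ℚ) → E (scale p d) g ≡ p * E d g
E-scale p d g = E-weights p _ (λ _ _ → refl) d g

supp-scale : (p : ℚ) (d : Dist A) → supp (scale p d) ≡ supp d
supp-scale p = supp-weights p _ (λ _ _ → refl)

E-bind : (d : Dist A) (f : A → Dist B) (g : B → ℚ) → E (d >>= f) g ≡ E d (λ a → E (f a) g)
E-bind []            f g = refl
E-bind ((a , p) ∷ d) f g = trans (sum-++ (map _ (f a)) (d >>= f) _)
  (cong₂ _+ℚ_ (E-weights p _ (λ _ _ → refl) (f a) g) (E-bind d f g))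

supp-bind : (d : Dist A) (f : A → Dist B) → supp (d >>= f) ≡ concatMap (supp ∘ f) (supp d)
supp-bind []            f = refl
supp-bind ((a , p) ∷ d) f = trans (map-++ proj₁ (map _ (f a)) (d >>= f))
  (cong₂ _++_ (supp-weights p _ (λ _ _ → refl) (f a)) (supp-bind d f))

≈-bind : {d d′ : Dist A} (f : A → Dist B) → d ≈ d′ → (d >>= f) ≈ (d′ >>= f)
≈-bind {d = d} {d′} f eq g = trans (E-bind d f g) (trans (eq _) (sym (E-bind d′ f g)))

∈-bind⁻ : (d : Dist A) (f : A → Dist B) {b : B} → b ∈ supp (d >>= f) → ∃[ a ] a ∈ supp d × b ∈ supp (f a)
∈-bind⁻ d f m = find (∈-concatMap⁻ (supp ∘ f) (subst (_ ∈_) (supp-bind d f) m))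

∈-bind⁺ : (d : Dist A) (f : A → Dist B) {a : A} {b : B} → a ∈ supp d → b ∈ supp (f a) → b ∈ supp (d >>= f)
∈-bind⁺ d f ma mb = subst (_ ∈_) (sym (supp-bind d f)) (∈-concatMap⁺ (supp ∘ f) (lose ma mb))

mass-bind : (d : Dist A) (f : A → Dist B) → mass d ≡ 1ℚ → (∀ {a} → a ∈ supp d → mass (f a) ≡ 1ℚ) →
  mass (d >>= f) ≡ 1ℚ
mass-bind d f md mf = trans (E-bind d f _) (trans (E-cong d mf) md)

uniform-map : (xs : List A) → uniform xs ≡ map (λ a → (a , frac 1 (length xs))) xs
uniform-map []       = refl
uniform-map (x ∷ xs) = refl

E-uniform : (xs : List A) (g : A → ℚ) → E (uniform xs) g ≡ frac 1 (length xs) * sumOf xs g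
E-uniform xs g rewrite uniform-map xs = trans (sum-map _ xs _) (sum-*ˡ (frac 1 (length xs)) xs g)

supp-uniform : (xs : List A) → supp (uniform xs) ≡ xs
supp-uniform xs rewrite uniform-map xs = trans (sym (map-∘ xs)) (map-id xs)

mass-uniform : (xs : List A) → 0 < length xs → mass (uniform xs) ≡ 1ℚ
mass-uniform xs pos = trans (E-uniform xs _) (trans (cong (frac 1 (length xs) *_) (sum-1 xs))
  (trans (ℚ.*-comm (frac 1 (length xs)) (ι (length xs))) (ι-frac pos)))

-- Uniformly weighted distributions

-- The uniform distribution on the elements satisfying `P`. The value of `w` is left open because
-- `unique` and `total` force it to be the reciprocal of the size of the support; `supp d` then
-- serves as an enumeration of `P` to sum over.
record Flat (d : Dist A) (w : ℚ) (P : A → Set) : Set where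
  field
    weight  : All (λ aq → proj₂ aq ≡ w) d
    unique  : Unique (supp d)
    support : ∀ {a} → a ∈ supp d ⇔ P a
    total   : mass d ≡ 1ℚ
open Flat

module _ {d : Dist A} {w : ℚ} {P : A → Set} (fl : Flat d w P) where
  Flat-E : (g : A → ℚ) → E d g ≡ w * sumOf (supp d) g
  Flat-E g = trans (sum-cong d (λ m → cong (_* _) (All.lookup (weight fl) m)))
    (trans (sum-*ˡ w d _) (cong (w *_) (sym (sum-map proj₁ d g))))

  Flat-⇔ : {Q : A → Set} → (∀ a → P a ⇔ Q a) → Flat d w Q
  Flat-⇔ eq = record
    { weight = weight fl ; unique = unique fl ; total = total fl
    ; support = mk⇔ (λ m → Equivalence.to (eq _) (Equivalence.to (support fl) m))
                     (λ q → Equivalence.from (support fl) (Equivalence.from (eq _) q)) }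

Flat-weight : {d : Dist A} {w w′ : ℚ} {P : A → Set} → w ≡ w′ → Flat d w P → Flat d w′ P
Flat-weight refl fl = fl

Flat-return : (a : A) → Flat (return a) 1ℚ (a ≡_)
Flat-return a = record
  { weight = refl ∷ [] ; unique = [] ∷ [] ; support = mk⇔ (λ { (here eq) → sym eq ; (there ()) }) (here ∘ sym)
  ; total = E-return a _ }

Flat-uniform : {xs : List A} → Unique xs → 0 < length xs → Flat (uniform xs) (frac 1 (length xs)) (_∈ xs)
Flat-uniform {xs = xs} u pos = record
  { weight  = subst (All _) (sym (uniform-map xs)) (AllP.map⁺ (All.universal (λ _ → refl) xs))
  ; unique  = subst Unique (sym (supp-uniform xs)) u
  ; support = mk⇔ (subst (_ ∈_) (supp-uniform xs)) (subst (_ ∈_) (sym (supp-uniform xs)))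
  ; total   = mass-uniform xs pos }

unique-concatMap : (f : A → List B) {xs : List A} → Unique xs → (∀ {x} → x ∈ xs → Unique (f x)) →
  (∀ {x y z} → x ∈ xs → y ∈ xs → z ∈ f x → z ∈ f y → x ≡ y) → Unique (concatMap f xs)
unique-concatMap f []                   uf sep = []
unique-concatMap f {x ∷ xs} (fresh ∷ u) uf sep = UP.++⁺ (uf (here refl))
  (unique-concatMap f u (uf ∘ there) (λ mx my → sep (there mx) (there my)))
  λ { (m , m′) → let (y , my , mz) = find (∈-concatMap⁻ f {xs = xs} m′) in
      All.lookup fresh my (sep (here refl) (there my) m mz) }

-- By the separation hypothesis each outcome reveals the intermediate value, so it is reached along
-- one path only and no weights add up. The second weight `w′` must be the same for all intermediate
-- values.
Flat-bind : {d : Dist A} {w w′ : ℚ} {P : A → Set} {f : A → Dist B} {Q : A → B → Set} →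
  Flat d w P → (∀ {a} → P a → Flat (f a) w′ (Q a)) → (∀ {a a′ b} → P a → P a′ → Q a b → Q a′ b → a ≡ a′) →
  Flat (d >>= f) (w * w′) (λ b → ∃[ a ] P a × Q a b)
Flat-bind {d = d} {w} {w′} {P} {f} {Q} fd ff sep = record
  { weight  = weights d (weight fd) (λ m → weight (ff (P-of m)))
  ; unique  = subst Unique (sym (supp-bind d f)) (unique-concatMap (supp ∘ f) (unique fd) (λ m → unique (ff (P-of m)))
      λ mx my mz mz′ → sep (P-of mx) (P-of my) (Equivalence.to (support (ff (P-of mx))) mz) (Equivalence.to (support (ff (P-of my))) mz′))
  ; support = mk⇔
      (λ m → let (a , ma , mb) = ∈-bind⁻ d f m in a , P-of ma , Equivalence.to (support (ff (P-of ma))) mb)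
      (λ { (a , p , q) → ∈-bind⁺ d f (Equivalence.from (support fd) p) (Equivalence.from (support (ff p)) q) })
  ; total   = mass-bind d f (total fd) (λ m → total (ff (P-of m))) }
  where
  P-of : ∀ {a} → a ∈ supp d → P a
  P-of = Equivalence.to (support fd)

  weights : ∀ e → All (λ aq → proj₂ aq ≡ w) e → (∀ {a} → a ∈ supp e → All (λ bq → proj₂ bq ≡ w′) (f a)) →
    All (λ bq → proj₂ bq ≡ w * w′) (e >>= f)
  weights []            []          al = []
  weights ((a , p) ∷ e) (refl ∷ es) al =
    AllP.++⁺ (All-weights p _ (λ _ _ → refl) (al (here refl))) (weights e es (al ∘ there))

point-mass : {d : Dist A} {x : A} → mass d ≡ 1ℚ → (∀ {a} → a ∈ supp d → a ≡ x) → d ≈ return x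
point-mass {d = d} {x} m only g = begin
  E d g                  ≡⟨ E-cong d (λ ma → trans (cong g (only ma)) (sym (ℚ.*-identityʳ (g x)))) ⟩
  E d (λ _ → g x * 1ℚ)   ≡⟨ E-*ˡ (g x) d _ ⟩
  g x * mass d           ≡⟨ trans (cong (g x *_) m) (ℚ.*-identityʳ (g x)) ⟩
  g x                    ≡⟨ E-return x g ⟨
  E (return x) g         ∎

-- Reversal of a kernel

module _ (_≟_ : DecidableEquality A) where
  δ : A → A → ℚ
  δ x a = if does (a ≟ x) then 1ℚ else 0ℚ

  δ-≡ : ∀ {x a} → a ≡ x → δ x a ≡ 1ℚ
  δ-≡ {x} {a} eq rewrite dec-true (a ≟ x) eq = refl

  δ-≢ : ∀ {x a} → a ≢ x → δ x a ≡ 0ℚ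
  δ-≢ {x} {a} ne rewrite dec-false (a ≟ x) ne = refl

  prob-E : (d : Dist A) (x : A) → prob _≟_ d x ≡ E d (δ x)
  prob-E []            x = refl
  prob-E ((a , p) ∷ d) x = cong₂ _+ℚ_ (lem (does (a ≟ x))) (prob-E d x)
    where
    lem : ∀ b → (if b then p else 0ℚ) ≡ p * (if b then 1ℚ else 0ℚ)
    lem true  = sym (ℚ.*-identityʳ p)
    lem false = sym (ℚ.*-zeroʳ p)

  ≈⇒prob : {d d′ : Dist A} → d ≈ d′ → ∀ x → prob _≟_ d x ≡ prob _≟_ d′ x
  ≈⇒prob {d} {d′} eq x = trans (prob-E d x) (trans (eq _) (sym (prob-E d′ x)))

  E-δ-zero : (d : Dist A) {x : A} → x ∉ supp d → E d (δ x) ≡ 0ℚ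
  E-δ-zero d {x} x∉ = E-zero d (λ m → δ-≢ (λ { refl → x∉ m }))

  E-δ-hit : {d : Dist A} {y : A} (x : A) → d ≡ return y → y ≡ x → E d (δ x) ≡ 1ℚ
  E-δ-hit {y = y} x refl eq = trans (E-return y (δ x)) (δ-≡ eq)

  E-δ-miss : {d : Dist A} {y : A} (x : A) → d ≡ return y → y ≢ x → E d (δ x) ≡ 0ℚ
  E-δ-miss {y = y} x refl ne = trans (E-return y (δ x)) (δ-≢ ne)

  E-expand : (d : Dist A) {xs : List A} → Unique xs → (∀ {a} → a ∈ supp d → a ∈ xs) → (g : A → ℚ) →
    E d g ≡ sumOf xs (λ x → E d (δ x) * g x)
  E-expand d {xs} u sub g = begin
    E d g
      ≡⟨ E-cong d (λ {a} m → sym (trans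
           (sum-single u (sub m) (λ x → δ x a * g x) (λ {x} _ ne → trans (cong (_* g x) (δ-≢ (≢-sym ne))) (ℚ.*-zeroˡ (g x))))
           (trans (cong (_* g a) (δ-≡ {a} refl)) (ℚ.*-identityˡ (g a))))) ⟩
    E d (λ a → sumOf xs (λ x → δ x a * g x))
      ≡⟨ sum-cong d (λ {aq} _ → sym (sum-*ˡ (proj₂ aq) xs _)) ⟩
    sumOf d (λ aq → sumOf xs (λ x → proj₂ aq * (δ x (proj₁ aq) * g x)))
      ≡⟨ sum-swap d xs _ ⟩
    sumOf xs (λ x → sumOf d (λ aq → proj₂ aq * (δ x (proj₁ aq) * g x)))
      ≡⟨ sum-cong xs (λ {x} _ → trans (sum-cong d (λ {aq} _ → sym (ℚ.*-assoc (proj₂ aq) _ _))) (sum-*ʳ (g x) d _)) ⟩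
    sumOf xs (λ x → E d (δ x) * g x) ∎

  -- Summing the balance equation over c turns the inflow at c′ into λ′ times the (unit) mass
  -- of the reversed kernel at c′; that the constant is right follows from both sides having mass 1.
  reversal : {d d′ : Dist A} {w w′ : ℚ} {P P′ : A → Set} → Flat d w P → Flat d′ w′ P′ →
    (f f′ : A → Dist A) (λ′ : ℚ) →
    (∀ {c} → P c → mass (f c) ≡ 1ℚ) → (∀ {c c′} → P c → c′ ∈ supp (f c) → P′ c′) →
    (∀ {c′} → P′ c′ → mass (f′ c′) ≡ 1ℚ) → (∀ {c c′} → P′ c′ → c ∈ supp (f′ c′) → P c) →
    (∀ {c c′} → P c → P′ c′ → E (f c) (δ c′) ≡ λ′ * E (f′ c′) (δ c)) →
    (d >>= f) ≈ d′
  reversal {d} {d′} {w} {w′} {P} {P′} fd fd′ f f′ λ′ mf sf mf′ sf′ balance g = begin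
    E (d >>= f) g                       ≡⟨ outflow g ⟩
    (w * λ′) * sumOf (supp d′) g        ≡⟨ cong (_* sumOf (supp d′) g) const ⟩
    w′ * sumOf (supp d′) g              ≡⟨ Flat-E fd′ g ⟨
    E d′ g                              ∎
    where
    P-of : ∀ {a} → a ∈ supp d → P a
    P-of = Equivalence.to (support fd)
    P′-of : ∀ {a} → a ∈ supp d′ → P′ a
    P′-of = Equivalence.to (support fd′)

    inflow : ∀ {c′} → c′ ∈ supp d′ → sumOf (supp d) (λ c → E (f c) (δ c′)) ≡ λ′
    inflow {c′} m′ = begin
      sumOf (supp d) (λ c → E (f c) (δ c′))
        ≡⟨ sum-cong (supp d) (λ m → balance (P-of m) (P′-of m′)) ⟩
      sumOf (supp d) (λ c → λ′ * E (f′ c′) (δ c))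
        ≡⟨ sum-*ˡ λ′ (supp d) _ ⟩
      λ′ * sumOf (supp d) (λ c → E (f′ c′) (δ c))
        ≡⟨ cong (λ′ *_) (trans (sum-cong (supp d) (λ _ → sym (ℚ.*-identityʳ _)))
             (sym (E-expand (f′ c′) (unique fd) (λ m → Equivalence.from (support fd) (sf′ (P′-of m′) m)) (λ _ → 1ℚ)))) ⟩
      λ′ * mass (f′ c′)
        ≡⟨ trans (cong (λ′ *_) (mf′ (P′-of m′))) (ℚ.*-identityʳ λ′) ⟩
      λ′ ∎

    outflow : ∀ g → E (d >>= f) g ≡ (w * λ′) * sumOf (supp d′) g
    outflow g = begin
      E (d >>= f) g
        ≡⟨ trans (E-bind d f g) (Flat-E fd _) ⟩
      w * sumOf (supp d) (λ c → E (f c) g)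
        ≡⟨ cong (w *_) (sum-cong (supp d) (λ {c} m →
             E-expand (f c) (unique fd′) (λ m′ → Equivalence.from (support fd′) (sf (P-of m) m′)) g)) ⟩
      w * sumOf (supp d) (λ c → sumOf (supp d′) (λ c′ → E (f c) (δ c′) * g c′))
        ≡⟨ cong (w *_) (sum-swap (supp d) (supp d′) _) ⟩
      w * sumOf (supp d′) (λ c′ → sumOf (supp d) (λ c → E (f c) (δ c′) * g c′))
        ≡⟨ cong (w *_) (sum-cong (supp d′) (λ {c′} m′ →
             trans (sum-*ʳ (g c′) (supp d) _) (cong (_* g c′) (inflow m′)))) ⟩
      w * sumOf (supp d′) (λ c′ → λ′ * g c′)
        ≡⟨ trans (cong (w *_) (sum-*ˡ λ′ (supp d′) g)) (sym (ℚ.*-assoc w λ′ _)) ⟩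
      (w * λ′) * sumOf (supp d′) g ∎

    -- Let `s` be the number of entries of `supp d′`. Both `(w * λ′) * s` and `w′ * s` equal 1, and
    -- multiplying crosswise avoids dividing by `s`.
    const : w * λ′ ≡ w′
    const = begin
      w * λ′                                           ≡⟨ ℚ.*-identityʳ _ ⟨
      (w * λ′) * 1ℚ                                    ≡⟨ cong (w * λ′ *_) (trans (sym (total fd′)) (Flat-E fd′ _)) ⟩
      (w * λ′) * (w′ * sumOf (supp d′) (λ _ → 1ℚ))
        ≡⟨ solve 3 (λ x y z → x :* (y :* z) := y :* (x :* z)) refl (w * λ′) w′ (sumOf (supp d′) (λ _ → 1ℚ)) ⟩
      w′ * ((w * λ′) * sumOf (supp d′) (λ _ → 1ℚ))     ≡⟨ cong (w′ *_) (outflow _) ⟨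
      w′ * mass (d >>= f)                              ≡⟨ cong (w′ *_) (mass-bind d f (total fd) (mf ∘ P-of)) ⟩
      w′ * 1ℚ                                          ≡⟨ ℚ.*-identityʳ w′ ⟩
      w′                                               ∎
      where open +-*-Solver

lookup-≗ : {xs ys : Vec A n} → (∀ i → lookup xs i ≡ lookup ys i) → xs ≡ ys
lookup-≗ {xs = xs} {ys} eq = trans (sym (tabulate∘lookup xs)) (trans (tabulate-cong eq) (tabulate∘lookup ys))

just≢nothing : {a : A} {m : Maybe A} → m ≡ just a → m ≢ nothing
just≢nothing refl ()

-- Counting with Boolean filters

filterᵇ-cong : {p q : A → Bool} → (∀ a → p a ≡ q a) → ∀ xs → filterᵇ p xs ≡ filterᵇ q xs
filterᵇ-cong {p = p} {q} eq =
  filter-≐ (T? ∘ p) (T? ∘ q) ((λ {a} → subst T (eq a)) , (λ {a} → subst T (sym (eq a))))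

∈-filterᵇ⁻ : (p : A → Bool) (xs : List A) {x : A} → x ∈ filterᵇ p xs → x ∈ xs × p x ≡ true
∈-filterᵇ⁻ p xs m = let (m′ , t) = ∈-filter⁻ (T? ∘ p) {xs = xs} m in m′ , Equivalence.to T-≡ t

∈-filterᵇ⁺ : (p : A → Bool) {xs : List A} {x : A} → x ∈ xs → p x ≡ true → x ∈ filterᵇ p xs
∈-filterᵇ⁺ p m eq = ∈-filter⁺ (T? ∘ p) m (Equivalence.from T-≡ eq)

-- The predicates differ only at `b`, which occurs exactly once. This serves both to count free
-- colours and to count the children of `p` when an edge is added.
filterᵇ-remove : (p q : A → Bool) {b : A} {xs : List A} → Unique xs → b ∈ xs → p b ≡ true → q b ≡ false →
  (∀ {a} → a ≢ b → q a ≡ p a) → length (filterᵇ p xs) ≡ suc (length (filterᵇ q xs))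
filterᵇ-remove p q {b} {xs = _ ∷ xs} (fresh ∷ u) (here refl) pb qb eq rewrite pb | qb =
  cong (suc ∘ length) (same xs fresh)
  where
  same : ∀ ys → All (b ≢_) ys → filterᵇ p ys ≡ filterᵇ q ys
  same []       []        = refl
  same (y ∷ ys) (ne ∷ fr) rewrite eq (≢-sym ne) with p y
  ... | true  = cong (y ∷_) (same ys fr)
  ... | false = same ys fr
filterᵇ-remove p q {xs = x ∷ xs} (fresh ∷ u) (there m) pb qb eq
  rewrite eq (All.lookup fresh m) with p x
... | true  = cong suc (filterᵇ-remove p q u m pb qb eq)
... | false = filterᵇ-remove p q u m pb qb eq

any-isJust= : {a : Fin κ} (us : List (Maybe (Fin κ))) → T (any (isJust= a) us) ⇔ just a ∈ us
any-isJust= {a = a} us = mk⇔ (λ t → let (u , m , tu) = find (AnyP.any⁻ (isJust= a) us t) in subst (_∈ us) (to u tu) m)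
  (λ m → AnyP.any⁺ (isJust= a) (lose m (subst T (sym (dec-true (a ≟F a) refl)) _)))
  where
  to : ∀ u → T (isJust= a u) → u ≡ just a
  to (just b) t with a ≟F b
  ... | yes refl = refl

isUnused : List (Maybe (Fin κ)) → Fin κ → Bool
isUnused us a = not (any (isJust= a) us)

-- Common form of `avail` (with the list `usedAt`) and `allowed` (with a one-element list), so that
-- both are counted by one lemma.
unused : List (Maybe (Fin κ)) → List (Fin κ)
unused {κ} us = filterᵇ (isUnused us) (allFin κ)

∈-unused : {a : Fin κ} (us : List (Maybe (Fin κ))) → a ∈ unused us ⇔ just a ∉ us
∈-unused {a = a} us = mk⇔
  (λ m j → T-absurd (proj₂ (∈-filterᵇ⁻ (isUnused us) (allFin _) m)) (Equivalence.from (any-isJust= us) j))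
  (λ j∉ → ∈-filterᵇ⁺ (isUnused us) (∈-allFin a) (not-any j∉))
  where
  T-absurd : ∀ {b} → not b ≡ true → ¬ T b
  T-absurd {false} _ ()
  not-any : just a ∉ us → not (any (isJust= a) us) ≡ true
  not-any j∉ with any (isJust= a) us in eq
  ... | false = refl
  ... | true  = ⊥-elim (j∉ (Equivalence.to (any-isJust= us) (subst T (sym eq) _)))

-- Each `just` entry removes one colour that no other entry removes, since the entries are distinct.
-- Stated as a sum to avoid truncated subtraction.
length-unused : {us : List (Maybe (Fin κ))} → Unique us → length (unused us) + length (catMaybes us) ≡ κ
length-unused {κ} {[]} [] = trans (ℕ.+-identityʳ _)
  (trans (cong length (filter-all (T? ∘ λ (_ : Fin κ) → true) (All.universal (λ _ → _) (allFin κ)))) (length-tabulate (λ (i : Fin κ) → i)))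
length-unused {us = nothing ∷ us} (_ ∷ u) = length-unused u
length-unused {κ} {us = just b ∷ us} (fresh ∷ u) = trans (ℕ.+-suc _ _) (trans (cong (_+ length (catMaybes us)) (sym rem)) (length-unused u))
  where
  ok : b ∈ unused us
  ok = Equivalence.from (∈-unused us) (λ m → All.lookup fresh m refl)
  rem : length (unused us) ≡ suc (length (unused (just b ∷ us)))
  rem = filterᵇ-remove (isUnused us) (isUnused (just b ∷ us)) (UP.allFin⁺ κ) (∈-allFin b)
    (proj₂ (∈-filterᵇ⁻ (isUnused us) (allFin _) ok))
    (cong (λ z → not (z ∨ any (isJust= b) us)) (dec-true (b ≟F b) refl))
    (λ {a} ne → cong (λ z → not (z ∨ any (isJust= a) us)) (dec-false (a ≟F b) ne))

allowed≡unused : (f : Maybe (Fin κ)) → allowed f ≡ unused (f ∷ [])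
allowed≡unused f = filterᵇ-cong {q = isUnused (f ∷ [])} (λ a → cong not (sym (∨-identityʳ (isJust= a f)))) (allFin _)

∈-allowed : {f : Maybe (Fin κ)} {a : Fin κ} → a ∈ allowed f ⇔ f ≢ just a
∈-allowed {f = f} = mk⇔
  (λ m eq → Equivalence.to (∈-unused (f ∷ [])) (subst (_ ∈_) (allowed≡unused f) m) (here (sym eq)))
  (λ ne → subst (_ ∈_) (sym (allowed≡unused f)) (Equivalence.from (∈-unused (f ∷ [])) λ { (here eq) → ne (sym eq) ; (there ()) }))

length-allowed : (f : Maybe (Fin κ)) → length (allowed f) + length (catMaybes (f ∷ [])) ≡ κ
length-allowed f = trans (cong (λ z → length z + length (catMaybes (f ∷ []))) (allowed≡unused f)) (length-unused {us = f ∷ []} ([] ∷ []))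

unique-map : (f : A → B) {xs : List A} → Unique xs → (∀ {x y} → x ∈ xs → y ∈ xs → f x ≡ f y → x ≡ y) →
  Unique (map f xs)
unique-map f []          inj = []
unique-map f (fresh ∷ u) inj =
  AllP.map⁺ (All.tabulate (λ m eq → All.lookup fresh m (inj (here refl) (there m) eq)))
  ∷ unique-map f u (λ mx my → inj (there mx) (there my))

-- Children, roots and proper colourings

∈-children⁻ : (F : Forest n) {v w : Fin n} → w ∈ children F v → lookup F w ≡ just v
∈-children⁻ F {v} {w} m = isParent⁻ (proj₂ (∈-filterᵇ⁻ (isParent F v) (allFin _) m))
  where
  isParent⁻ : isParent F v w ≡ true → lookup F w ≡ just v
  isParent⁻ t with lookup F w
  ... | just u with u ≟F v
  ...   | yes refl = refl

∈-children⁺ : (F : Forest n) {v w : Fin n} → lookup F w ≡ just v → w ∈ children F v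
∈-children⁺ F {v} {w} e = ∈-filterᵇ⁺ (isParent F v) (∈-allFin w) (isParent⁺ e)
  where
  isParent⁺ : lookup F w ≡ just v → isParent F v w ≡ true
  isParent⁺ eq with lookup F w
  isParent⁺ refl | just .v = dec-true (v ≟F v) refl

children-unique : (F : Forest n) (v : Fin n) → Unique (children F v)
children-unique {n} F v = UP.filter⁺ (T? ∘ isParent F v) (UP.allFin⁺ n)

isRoot-nothing : {F : Forest n} {v : Fin n} → lookup F v ≡ nothing → isRoot F v ≡ true
isRoot-nothing {F = F} {v} eq with lookup F v
isRoot-nothing refl | nothing = refl

isRoot-just : {F : Forest n} {v y : Fin n} → lookup F v ≡ just y → isRoot F v ≡ false
isRoot-just {F = F} {v} eq with lookup F v
isRoot-just refl | just _ = refl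

∈-roots⁻ : (F : Forest n) {v : Fin n} → v ∈ roots F → lookup F v ≡ nothing
∈-roots⁻ F {v} m = isRoot⁻ (proj₂ (∈-filterᵇ⁻ (isRoot F) (allFin _) m))
  where
  isRoot⁻ : isRoot F v ≡ true → lookup F v ≡ nothing
  isRoot⁻ t with lookup F v
  ... | nothing = refl

∈-roots⁺ : (F : Forest n) {v : Fin n} → lookup F v ≡ nothing → v ∈ roots F
∈-roots⁺ F {v} e = ∈-filterᵇ⁺ (isRoot F) (∈-allFin v) (isRoot-nothing {F = F} e)

roots-unique : (F : Forest n) → Unique (roots F)
roots-unique {n} F = UP.filter⁺ (T? ∘ isRoot F) (UP.allFin⁺ n)

-- An edge is represented by its lower endpoint, so two edges that meet are either siblings or an
-- edge and the parent edge above it. If `y` is a root, its entry is `nothing` and `parent` excludes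
-- no colour. The field `root` makes the vector determined by the edge colours.
record Proper (F : Forest n) (c : Coloring n κ) : Set where
  field
    root    : ∀ {x} → lookup F x ≡ nothing → lookup c x ≡ nothing
    edge    : ∀ {x y} → lookup F x ≡ just y → ∃[ a ] lookup c x ≡ just a
    sibling : ∀ {x x′ y} → lookup F x ≡ just y → lookup F x′ ≡ just y → lookup c x ≡ lookup c x′ → x ≡ x′
    parent  : ∀ {x y} → lookup F x ≡ just y → lookup c x ≢ lookup c y
open Proper

∈-usedAt⁻ : {F : Forest n} {c : Coloring n κ} {x : Fin n} {a : Fin κ} → just a ∈ usedAt F c x →
  (∃[ y ] lookup F x ≡ just y × lookup c x ≡ just a) ⊎ (∃[ w ] lookup F w ≡ just x × lookup c w ≡ just a)
∈-usedAt⁻ {F = F} {c} {x} (here eq) with lookup F x in e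
... | just y = inj₁ (y , refl , sym eq)
∈-usedAt⁻ {F = F} {c} (there m) = let (w , mw , eq) = ∈-map⁻ (lookup c) m in
  inj₂ (w , ∈-children⁻ F mw , sym eq)

∈-usedAt⁺ˡ : {F : Forest n} {c : Coloring n κ} {x y : Fin n} {a : Fin κ} →
  lookup F x ≡ just y → lookup c x ≡ just a → just a ∈ usedAt F c x
∈-usedAt⁺ˡ {F = F} {c} {x} e eq with lookup F x
∈-usedAt⁺ˡ refl eq | just _ = here (sym eq)

∈-usedAt⁺ʳ : {F : Forest n} {c : Coloring n κ} {x w : Fin n} {a : Fin κ} →
  lookup F w ≡ just x → lookup c w ≡ just a → just a ∈ usedAt F c x
∈-usedAt⁺ʳ {F = F} {c} {x} e eq = there (subst (_∈ map (lookup c) (children F x)) eq (∈-map⁺ (lookup c) (∈-children⁺ F e)))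

catMaybes-map : (f : A → Maybe B) (xs : List A) → (∀ {x} → x ∈ xs → ∃[ b ] f x ≡ just b) →
  length (catMaybes (map f xs)) ≡ length xs
catMaybes-map f []       j = refl
catMaybes-map f (x ∷ xs) j with f x | j (here refl)
... | just _ | _ = cong suc (catMaybes-map f xs (j ∘ there))

-- Properness makes the entries of `usedAt` distinct, with one colour per incident edge. This is why
-- the number of free colours depends on the degree alone.
length-avail : {F : Forest n} {c : Coloring n κ} → Proper F c → ∀ x → length (avail F c x) + deg F x ≡ κ
length-avail {F = F} {c} pr x = trans (cong (λ z → length (avail F c x) + z) (sym count)) (length-unused uniq)
  where
  ch = children F x
  uch : Unique (map (lookup c) ch)
  uch = unique-map (lookup c) (children-unique F x)
    (λ mx my eq → sibling pr (∈-children⁻ F mx) (∈-children⁻ F my) eq)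
  justs : ∀ {w} → w ∈ ch → ∃[ b ] lookup c w ≡ just b
  justs m = edge pr (∈-children⁻ F m)
  uniq : Unique (usedAt F c x)
  uniq with lookup F x in e
  ... | nothing = AllP.map⁺ (All.tabulate (λ m eq → just≢nothing (proj₂ (justs m)) (sym eq))) ∷ uch
  ... | just y  = AllP.map⁺ (All.tabulate (λ m eq → parent pr (∈-children⁻ F m) (sym eq))) ∷ uch
  count : length (catMaybes (usedAt F c x)) ≡ deg F x
  count with lookup F x in e
  ... | nothing = trans (catMaybes-map (lookup c) ch justs) (sym (ℕ.+-identityʳ _))
  ... | just y with lookup c x | edge pr e
  ...   | just a | _ = trans (cong suc (catMaybes-map (lookup c) ch justs)) (ℕ.+-comm 1 _)

hasColor-≡ : {c : Coloring n κ} {β : Fin κ} {w : Fin n} → hasColor c β w ≡ true ⇔ lookup c w ≡ just β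
hasColor-≡ {c = c} {β} {w} = mk⇔ to from
  where
  to : hasColor c β w ≡ true → lookup c w ≡ just β
  to t with lookup c w
  ... | just a with a ≟F β
  ...   | yes refl = refl
  from : lookup c w ≡ just β → hasColor c β w ≡ true
  from eq with lookup c w
  from refl | just .β = dec-true (β ≟F β) refl

childWithColor-just : {F : Forest n} {c : Coloring n κ} {v w : Fin n} {β : Fin κ} →
  childWithColor F c v β ≡ just w → lookup F w ≡ just v × lookup c w ≡ just β
childWithColor-just {F = F} {c} {v} {w} {β} eq with filterᵇ (hasColor c β) (children F v) in e
childWithColor-just {F = F} {c} {v} {w} {β} refl | .w ∷ _ =
  let (m , h) = ∈-filterᵇ⁻ (hasColor c β) (children F v) (subst (w ∈_) (sym e) (here refl)) in
  ∈-children⁻ F m , Equivalence.to (hasColor-≡ {c = c}) h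

childWithColor-nothing : {F : Forest n} {c : Coloring n κ} {v w : Fin n} {β : Fin κ} →
  childWithColor F c v β ≡ nothing → lookup F w ≡ just v → lookup c w ≢ just β
childWithColor-nothing {F = F} {c} {v} {w} {β} eq e cw
  with filterᵇ (hasColor c β) (children F v)
     | ∈-filterᵇ⁺ (hasColor c β) (∈-children⁺ F e) (Equivalence.from (hasColor-≡ {c = c}) cw)
childWithColor-nothing () e cw | _ ∷ _ | _
childWithColor-nothing eq e cw | [] | ()

-- Ranks

-- A certificate of acyclicity. The bound `rank<n` is what makes fuel `n` sufficient for every
-- recursion along the forest.
record Ranked (F : Forest n) : Set where
  field
    rank     : Fin n → ℕ
    rank-par : ∀ {x y} → lookup F x ≡ just y → rank y < rank x
    rank<n   : ∀ x → rank x < n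
open Ranked

length-filter-< : {P Q : A → Set} (P? : ∀ a → Dec (P a)) (Q? : ∀ a → Dec (Q a)) → (∀ {a} → P a → Q a) →
  ∀ {x xs} → x ∈ xs → Q x → ¬ P x → length (filter P? xs) < length (filter Q? xs)
length-filter-< P? Q? sub {x} m qx ¬px = go m
  where
  le : ∀ xs → length (filter P? xs) ≤ length (filter Q? xs)
  le [] = z≤n
  le (y ∷ ys) with P? y | Q? y
  ... | yes _ | yes _ = s≤s (le ys)
  ... | yes p | no ¬q = ⊥-elim (¬q (sub p))
  ... | no _  | yes _ = ℕ.m≤n⇒m≤1+n (le ys)
  ... | no _  | no _  = le ys
  go : ∀ {xs} → x ∈ xs → length (filter P? xs) < length (filter Q? xs)
  go {y ∷ ys} (here refl) with P? y | Q? y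
  ... | yes p | _     = ⊥-elim (¬px p)
  ... | no _  | yes _ = s≤s (le ys)
  ... | no _  | no ¬q = ⊥-elim (¬q qx)
  go {y ∷ ys} (there m) with P? y | Q? y
  ... | yes _ | yes _ = s≤s (go m)
  ... | yes p | no ¬q = ⊥-elim (¬q (sub p))
  ... | no _  | yes _ = ℕ.m≤n⇒m≤1+n (go m)
  ... | no _  | no _  = go m

-- Replacing h x by the number of vertices of smaller height bounds the ranks by n.
rank-by : {F : Forest n} (h : Fin n → ℕ) → (∀ {x y} → lookup F x ≡ just y → h y < h x) → Ranked F
rank-by {n} h par = record
  { rank     = λ x → length (filter (below x) (allFin n))
  ; rank-par = λ {x} {y} e → length-filter-< (below y) (below x) (λ lt → ℕ.<-trans lt (par e)) (∈-allFin y) (par e) (ℕ.<-irrefl refl)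
  ; rank<n   = λ x → subst (length (filter (below x) (allFin n)) <_) (length-tabulate (λ (i : Fin n) → i)) (filter-notAll (below x) (allFin n) (lose (∈-allFin x) (ℕ.<-irrefl refl)))
  }
  where
  below : ∀ x y → Dec (h y < h x)
  below x y = h y <? h x

ranked-empty : Ranked (emptyF {n})
ranked-empty = rank-by (λ _ → 0) (λ {x} e → ⊥-elim (just≢nothing e (lookup-replicate x nothing)))

lookup-cut : {F : Forest n} {r x y : Fin n} → lookup (F [ r ]≔ nothing) x ≡ just y → lookup F x ≡ just y
lookup-cut {F = F} {r} {x} e with x ≟F r
... | yes refl = ⊥-elim (just≢nothing e (lookup∘update r F nothing))
... | no ne    = trans (sym (lookup∘update′ ne F nothing)) e

ranked-cut : {F : Forest n} {r : Fin n} → Ranked F → Ranked (F [ r ]≔ nothing)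
ranked-cut {F = F} rk = record { rank = rank rk ; rank-par = rank-par rk ∘ lookup-cut {F = F} ; rank<n = rank<n rk }

ancOrSelf-self : ∀ k {F : Forest n} {a} → ancOrSelf (suc k) F a a ≡ true
ancOrSelf-self k {F} {a} rewrite dec-true (a ≟F a) refl = refl

-- The walk to the root passes through strictly decreasing ranks, so it ends before the last unit of
-- fuel is used.
ancOrSelf-fuel : {F : Forest n} (rk : Ranked F) {a : Fin n} → ∀ k {x} → rank rk x < k →
  ancOrSelf (suc k) F a x ≡ true → ancOrSelf k F a x ≡ true
ancOrSelf-fuel {F = F} rk {a} (suc k) {x} lt eq with a == x | lookup F x in e
... | true  | _      = refl
... | false | just y = ancOrSelf-fuel rk k (ℕ.<-≤-trans (rank-par rk e) (s≤s⁻¹ lt)) eq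

ancOrSelf-child : {F : Forest n} {a x y : Fin n} → ∀ k → lookup F x ≡ just y →
  ancOrSelf k F a y ≡ true → ancOrSelf (suc k) F a x ≡ true
ancOrSelf-child {F = F} {a} {x} k e eq with a == x | lookup F x
... | true | _ = refl
ancOrSelf-child k refl eq | false | just y = eq

-- Raise every vertex of the subtree of `r` by the number of vertices. Then `r` is above all old
-- ranks, in particular that of `p`, which is not raised as it lies outside that subtree. `rank-by`
-- compresses the heights again.
ranked-link : {F : Forest n} {p r : Fin n} → Ranked F → ancOrSelf n F r p ≡ false → Ranked (F [ r ]≔ just p)
ranked-link {suc n} {F} {p} {r} rk notAnc = rank-by h par
  where
  lift : Bool → ℕ
  lift b = if b then suc n else 0
  h : Fin (suc n) → ℕ
  h x = lift (ancOrSelf (suc n) F r x) + rank rk x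
  par : ∀ {x y} → lookup (F [ r ]≔ just p) x ≡ just y → h y < h x
  par {x} {y} e with x ≟F r
  ... | yes refl with refl ← trans (sym e) (lookup∘update r F (just p))
    rewrite notAnc | ancOrSelf-self n {F} {r} = ℕ.<-≤-trans (rank<n rk p) (ℕ.m≤m+n (suc n) _)
  ... | no ne = ℕ.+-mono-≤-< mono (rank-par rk e′)
    where
    e′ : lookup F x ≡ just y
    e′ = trans (sym (lookup∘update′ ne F (just p))) e
    mono : lift (ancOrSelf (suc n) F r y) ≤ lift (ancOrSelf (suc n) F r x)
    mono with ancOrSelf (suc n) F r y in ay
    ... | false = z≤n
    ... | true  = ℕ.≤-reflexive (sym (cong lift (ancOrSelf-child {F = F} {r} n e′
      (ancOrSelf-fuel rk n (ℕ.<-≤-trans (rank-par rk e′) (s≤s⁻¹ (rank<n rk x))) ay))))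

-- Arrangements

picks-firsts : (S : List A) → map proj₁ (picks S) ≡ S
picks-firsts []      = refl
picks-firsts (x ∷ S) = cong (x ∷_) (trans (sym (map-∘ (picks S))) (picks-firsts S))

picks-length : {S : List A} {x : A} {rest : List A} → (x , rest) ∈ picks S → length S ≡ suc (length rest)
picks-length {S = y ∷ S} (here refl) = refl
picks-length {S = y ∷ S} (there m) with ∈-map⁻ _ m
... | (_ , m′ , refl) = cong suc (picks-length m′)

picks-rest : {S : List A} {x : A} {rest : List A} → Unique S → (x , rest) ∈ picks S →
  x ∈ S × Unique rest × (∀ {y} → y ∈ rest ⇔ (y ∈ S × x ≢ y))
picks-rest {S = z ∷ S} (fresh ∷ u) (here refl) = here refl , u ,
  mk⇔ (λ m → there m , All.lookup fresh m) (λ { (here refl , ne) → ⊥-elim (ne refl) ; (there m , _) → m })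
picks-rest {S = z ∷ S} {x} (fresh ∷ u) (there m) with ∈-map⁻ _ m
... | ((_ , rest) , m′ , refl) = let (mx , ur , iff) = picks-rest u m′ in
  there mx ,
  (All.tabulate (λ mz → All.lookup fresh (proj₁ (Equivalence.to iff mz))) ∷ ur) ,
  mk⇔ (λ { (here refl) → here refl , ≢-sym (All.lookup fresh mx)
         ; (there mr) → let (a , b) = Equivalence.to iff mr in there a , b })
      (λ { (here refl , _) → here refl ; (there mr , ne) → there (Equivalence.from iff (mr , ne)) })

∈-picks : {S : List A} {x : A} → x ∈ S → ∃[ rest ] (x , rest) ∈ picks S
∈-picks {S = S} m with ∈-map⁻ proj₁ (subst (_ ∈_) (sym (picks-firsts S)) m)
... | ((_ , rest) , m′ , refl) = rest , m′

unique-map⁻ : (f : A → B) {xs : List A} {x y : A} → Unique (map f xs) → x ∈ xs → y ∈ xs → f x ≡ f y → x ≡ y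
unique-map⁻ f (_ ∷ _)     (here refl) (here refl) eq = refl
unique-map⁻ f (fresh ∷ _) (here refl) (there my)  eq = ⊥-elim (All.lookup fresh (∈-map⁺ f my) eq)
unique-map⁻ f (fresh ∷ _) (there mx)  (here refl) eq = ⊥-elim (All.lookup fresh (∈-map⁺ f mx) (sym eq))
unique-map⁻ f (_ ∷ u)     (there mx)  (there my)  eq = unique-map⁻ f u mx my eq

-- The falling factorial m(m-1)...(m-k+1), which counts injective sequences of length k.
perm : ℕ → ℕ → ℕ
perm m       zero    = 1
perm zero    (suc k) = 0
perm (suc m) (suc k) = suc m *ℕ perm m k

perm>0 : ∀ {m k} → k ≤ m → 0 < perm m k
perm>0 {k = zero}    _ = s≤s z≤n
perm>0 {suc m} {suc k} (s≤s le) = ℕ.*-mono-< {0} {suc m} {0} (s≤s z≤n) (perm>0 le)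

length-concatMap : (f : B → List A) (xs : List B) (l : ℕ) → (∀ {x} → x ∈ xs → length (f x) ≡ l) →
  length (concatMap f xs) ≡ length xs *ℕ l
length-concatMap f []       l eq = refl
length-concatMap f (x ∷ xs) l eq = trans (length-++ (f x))
  (cong₂ _+_ (eq (here refl)) (length-concatMap f xs l (eq ∘ there)))

Arrangement : List A → ℕ → List A → Set
Arrangement S k cs = length cs ≡ k × Unique cs × All (_∈ S) cs

module _ {A : Set} where

  private
    extend : ℕ → A × List A → List (List A)
    extend k (x , rest) = map (x ∷_) (arrangements rest k)

    arrangements-suc : (S : List A) (k : ℕ) → arrangements S (suc k) ≡ concatMap (extend k) (picks S)
    arrangements-suc S k = cong concat (map-cong (λ _ → refl) (picks S))

  ∈-arrangements⁻ : {S : List A} → Unique S → ∀ k {cs} → cs ∈ arrangements S k → Arrangement S k cs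
  ∈-arrangements⁻ u zero (here refl) = refl , [] , []
  ∈-arrangements⁻ {S} u (suc k) m
    with find (∈-concatMap⁻ (extend k) {xs = picks S} (subst (_ ∈_) (arrangements-suc S k) m))
  ... | ((x , rest) , mp , mc) with ∈-map⁻ (x ∷_) mc
  ... | (cs , mcs , refl) = let (mx , ur , iff) = picks-rest u mp
                                (len , ucs , al) = ∈-arrangements⁻ ur k mcs in
    cong suc len ,
    (All.map (λ m → proj₂ (Equivalence.to iff m)) al ∷ ucs) ,
    (mx ∷ All.map (λ m → proj₁ (Equivalence.to iff m)) al)

  ∈-arrangements⁺ : {S : List A} → Unique S → ∀ k {cs} → Arrangement S k cs → cs ∈ arrangements S k
  ∈-arrangements⁺ u zero {[]} _ = here refl
  ∈-arrangements⁺ {S} u (suc k) {x ∷ cs} (len , fresh ∷ ucs , mx ∷ al) =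
    let (rest , mp) = ∈-picks mx
        (_ , ur , iff) = picks-rest u mp in
    subst (_ ∈_) (sym (arrangements-suc S k)) (∈-concatMap⁺ (extend k) (lose mp (∈-map⁺ (x ∷_)
      (∈-arrangements⁺ ur k (ℕ.suc-injective len , ucs , All.tabulate (λ m →
        Equivalence.from iff (All.lookup al m , All.lookup fresh m)))))))

  arrangements-unique : {S : List A} → Unique S → ∀ k → Unique (arrangements S k)
  arrangements-unique u zero = [] ∷ []
  arrangements-unique {S} u (suc k) = subst Unique (sym (arrangements-suc S k))
    (unique-concatMap (extend k)
      (UP.map⁻ {f = proj₁} (subst Unique (sym (picks-firsts S)) u))
      (λ {p} mp → UP.map⁺ (proj₂ ∘ ∷-injective) (arrangements-unique (proj₁ (proj₂ (picks-rest u mp))) k))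
      (λ mp mq mz mz′ → unique-map⁻ proj₁ (subst Unique (sym (picks-firsts S)) u) mp mq (same mz mz′)))
    where
    same : ∀ {p q z} → z ∈ extend k p → z ∈ extend k q → proj₁ p ≡ proj₁ q
    same {p} {q} mz mz′ with ∈-map⁻ (proj₁ p ∷_) mz | ∈-map⁻ (proj₁ q ∷_) mz′
    ... | (_ , _ , refl) | (_ , _ , eq) = proj₁ (∷-injective eq)

  length-arrangements : (S : List A) (k : ℕ) → length (arrangements S k) ≡ perm (length S) k
  length-arrangements S        zero    = refl
  length-arrangements []       (suc k) = refl
  length-arrangements S@(_ ∷ S′) (suc k) = trans (cong length (arrangements-suc S k)) (trans
    (length-concatMap (extend k) (picks S) (perm (length S′) k) (λ {p} m → trans (length-map (proj₁ p ∷_) (arrangements (proj₂ p) k))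
      (trans (length-arrangements (proj₂ p) k) (cong (λ z → perm z k) (sym (ℕ.suc-injective (picks-length m)))))))
    (cong (_*ℕ perm (length S′) k) (trans (sym (length-map proj₁ (picks S))) (cong length (picks-firsts S)))))

-- Ancestors

data Anc (F : Forest n) (v : Fin n) : Fin n → Set where
  self : Anc F v v
  up   : ∀ {x y} → lookup F x ≡ just y → Anc F v y → Anc F v x

Anc-trans : {F : Forest n} {u v w : Fin n} → Anc F u v → Anc F v w → Anc F u w
Anc-trans a self     = a
Anc-trans a (up e b) = up e (Anc-trans a b)

-- Parents are unique, so the ancestors of a vertex form a chain.
Anc-comparable : {F : Forest n} {v w x : Fin n} → Anc F v x → Anc F w x → Anc F v w ⊎ Anc F w v
Anc-comparable self     a        = inj₂ a
Anc-comparable a        self     = inj₁ a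
Anc-comparable (up e a) (up f b) with refl ← trans (sym e) f = Anc-comparable a b

-- `Anc` climbs from the lower vertex, whereas the samplers descend from the upper one; this exposes
-- the first step of the descent.
Anc-child : {F : Forest n} {v y z : Fin n} → Anc F v z → lookup F y ≡ just z → ∃[ u ] lookup F u ≡ just v × Anc F u y
Anc-child self     e = _ , e , self
Anc-child (up f a) e = let (u , eu , au) = Anc-child a f in u , eu , up e au

module _ {F : Forest n} (rk : Ranked F) where

  Anc-rank : ∀ {v x} → Anc F v x → rank rk v ≤ rank rk x
  Anc-rank self     = ℕ.≤-refl
  Anc-rank (up e a) = ℕ.≤-trans (Anc-rank a) (ℕ.<⇒≤ (rank-par rk e))

  Anc-sibling : ∀ {v w y} → lookup F v ≡ just y → lookup F w ≡ just y → Anc F v w → v ≡ w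
  Anc-sibling ev ew self = refl
  Anc-sibling ev ew (up e a) with refl ← trans (sym ew) e =
    ⊥-elim (ℕ.<-irrefl refl (ℕ.<-≤-trans (rank-par rk ev) (Anc-rank a)))

  find-root : ∀ k x → rank rk x < k → ∃[ v ] lookup F v ≡ nothing × Anc F v x
  find-root (suc k) x lt with lookup F x in e
  ... | nothing = x , e , self
  ... | just y  = let (v , ev , a) = find-root k y (ℕ.<-≤-trans (rank-par rk e) (s≤s⁻¹ lt)) in v , ev , up e a

-- Disjointness of the subtrees hanging from the listed vertices; it ensures that samplers run one
-- after another never overwrite each other.
Separated : Forest n → List (Fin n) → Set
Separated F ws = ∀ {v w x} → v ∈ ws → w ∈ ws → Anc F v x → Anc F w x → v ≡ w

children-separated : {F : Forest n} → Ranked F → ∀ y → Separated F (children F y)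
children-separated {F = F} rk y mv mw av aw with Anc-comparable av aw
... | inj₁ a = Anc-sibling rk (∈-children⁻ F mv) (∈-children⁻ F mw) a
... | inj₂ a = sym (Anc-sibling rk (∈-children⁻ F mw) (∈-children⁻ F mv) a)

Anc-root : {F : Forest n} {v w : Fin n} → lookup F w ≡ nothing → Anc F v w → v ≡ w
Anc-root e self     = refl
Anc-root e (up f _) = ⊥-elim (just≢nothing f e)

roots-separated : (F : Forest n) → Separated F (roots F)
roots-separated F mv mw av aw with Anc-comparable av aw
... | inj₁ a = Anc-root (∈-roots⁻ F mw) a
... | inj₂ a = sym (Anc-root (∈-roots⁻ F mv) a)

-- Samplers that recolour a region

Region : ℕ → Set
Region n = Fin n → Bool

Off : Region n → Coloring n κ → Coloring n κ → Set
Off R c c′ = ∀ x → R x ≡ false → lookup c′ x ≡ lookup c x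

-- The intermediate colouring can be read off the final one: on `R` it agrees with the result,
-- because the second stage leaves `R` alone, and elsewhere it agrees with `c`. Since `C` looks only
-- at `R`, the second stage cannot spoil it.
seq : {c : Coloring n κ} {d : Dist (Coloring n κ)} {s : Coloring n κ → Dist (Coloring n κ)}
  {w w′ : ℚ} {R R′ : Region n} {C C′ : Coloring n κ → Set} →
  Flat d w (λ c′ → Off R c c′ × C c′) → (∀ c₁ → Flat (s c₁) w′ (λ c′ → Off R′ c₁ c′ × C′ c′)) →
  (∀ x → R x ≡ true → R′ x ≡ false) →
  (∀ {c₁ c₂} → (∀ x → R x ≡ true → lookup c₁ x ≡ lookup c₂ x) → C c₁ → C c₂) →
  Flat (d >>= s) (w * w′) (λ c′ → Off (λ x → R x ∨ R′ x) c c′ × C c′ × C′ c′)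
seq {n} {κ} {c = c} {R = R} {R′} {C} {C′} fd fs disj local = Flat-⇔ (Flat-bind fd (λ {c₁} _ → fs c₁) sep) λ c′ → mk⇔ (to c′) (from c′)
  where
  sep : ∀ {a a′ b : Coloring n κ} → Off R c a × C a → Off R c a′ × C a′ → Off R′ a b × C′ b → Off R′ a′ b × C′ b → a ≡ a′
  sep (o , _) (o′ , _) (q , _) (q′ , _) = lookup-≗ same
    where
    same : ∀ x → _
    same x with R′ x in r′ | R x in r
    ... | false | _     = trans (sym (q x r′)) (q′ x r′)
    ... | true  | false = trans (o x r) (sym (o′ x r))
    ... | true  | true  with () ← trans (sym r′) (disj x r)

  to : ∀ c′ → ∃[ a ] (Off R c a × C a) × (Off R′ a c′ × C′ c′) → Off (λ x → R x ∨ R′ x) c c′ × C c′ × C′ c′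
  to c′ (a , (o , ca) , (o′ , cc)) =
    off , local (λ x r → sym (o′ x (disj x r))) ca , cc
    where
    off : Off (λ x → R x ∨ R′ x) c c′
    off x eq with R x in r | R′ x in r′
    ... | false | false = trans (o′ x r′) (o x r)

  from : ∀ c′ → Off (λ x → R x ∨ R′ x) c c′ × C c′ × C′ c′ → ∃[ a ] (Off R c a × C a) × (Off R′ a c′ × C′ c′)
  from c′ (o , cc , cc′) = a , (off , local agree cc) , (off′ , cc′)
    where
    a : Coloring n κ
    a = tabulate (λ x → if R x then lookup c′ x else lookup c x)
    off : Off R c a
    off x r = trans (lookup∘tabulate _ x) (cong (λ b → if b then lookup c′ x else lookup c x) r)
    agree : ∀ x → R x ≡ true → lookup c′ x ≡ lookup a x
    agree x r = sym (trans (lookup∘tabulate _ x) (cong (λ b → if b then lookup c′ x else lookup c x) r))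
    off′ : Off R′ a c′
    off′ x r′ = trans (lem (R x) refl) (sym (lookup∘tabulate _ x))
      where
      lem : ∀ b → R x ≡ b → lookup c′ x ≡ (if b then lookup c′ x else lookup c x)
      lem true  _ = refl
      lem false r = o x (cong₂ _∨_ r r′)

mutual
  -- Follows the recursion and the fuel of `sampleBelow`, so that it is the set of entries written
  -- by a call with this fuel; the link to `Anc` is proved separately.
  below : ℕ → Forest n → Fin n → Region n
  below zero    F v x = false
  below (suc k) F v x = any (λ w → touched k F w x) (children F v)

  touched : ℕ → Forest n → Fin n → Region n
  touched k F w x = (w == x) ∨ below k F w x

touchedAny : ℕ → Forest n → List (Fin n) → Region n
touchedAny k F ws x = any (λ w → touched k F w x) ws

==-refl : (x : Fin n) → x == x ≡ true
==-refl x = dec-true (x ≟F x) refl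

any-true⁻ : (p : A → Bool) (xs : List A) → any p xs ≡ true → ∃[ x ] x ∈ xs × p x ≡ true
any-true⁻ p xs eq = let (x , m , t) = find (AnyP.any⁻ p xs (Equivalence.from T-≡ eq)) in x , m , Equivalence.to T-≡ t

any-true⁺ : (p : A → Bool) {xs : List A} {x : A} → x ∈ xs → p x ≡ true → any p xs ≡ true
any-true⁺ p m eq = Equivalence.to T-≡ (AnyP.any⁺ p (lose m (Equivalence.from T-≡ eq)))

any-false : (p : A → Bool) (xs : List A) → (∀ {x} → x ∈ xs → p x ≢ true) → any p xs ≡ false
any-false p xs none with any p xs in eq
... | false = refl
... | true  = let (_ , m , t) = any-true⁻ p xs eq in ⊥-elim (none m t)

mutual
  below⇒Anc : ∀ k {F : Forest n} {v x} → below k F v x ≡ true → ∃[ y ] lookup F x ≡ just y × Anc F v y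
  below⇒Anc (suc k) {F} {v} {x} eq with any-true⁻ (λ w → touched k F w x) (children F v) eq
  ... | (w , m , t) with touched⇒Anc k t
  ...   | self   = v , ∈-children⁻ F m , self
  ...   | up e a = _ , e , Anc-trans (up (∈-children⁻ F m) self) a

  touched⇒Anc : ∀ k {F : Forest n} {w x} → touched k F w x ≡ true → Anc F w x
  touched⇒Anc k {F} {w} {x} eq with w ≟F x
  ... | yes refl = self
  ... | no _     = let (_ , e , a) = below⇒Anc k eq in up e a

Good : Forest n → Fin n → Maybe (Fin κ) → Coloring n κ → Set
Good F v f c = ∃[ cols ] cols ∈ arrangements (allowed f) (length (children F v))
                         × map (lookup c) (children F v) ≡ map just cols

-- The colour forbidden below a child `w` is read from `c` itself: the sampler writes it at `w` just
-- before descending and does not touch it afterwards.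
Below : ℕ → Forest n → Fin n → Maybe (Fin κ) → Coloring n κ → Set
Below zero    F v f c = ⊤
Below (suc k) F v f c = Good F v f c × All (λ w → Below k F w (lookup c w) c) (children F v)

Below-local : ∀ k {F : Forest n} {v f} {c c′ : Coloring n κ} →
  (∀ x → below k F v x ≡ true → lookup c x ≡ lookup c′ x) → Below k F v f c → Below k F v f c′
Below-local zero agree _ = tt
Below-local (suc k) {F} {v} {f} {c} {c′} agree ((cols , m , eq) , al) =
  (cols , m , trans (sym (map-cong-∈ (children F v) at)) eq) ,
  All.tabulate (λ {w} mw → subst (λ z → Below k F w z c′) (at mw)
    (Below-local k (λ x b → agree x (any-true⁺ (λ w → touched k F w x) mw (trans (cong ((w == x) ∨_) b) (∨-zeroʳ (w == x))))) (All.lookup al mw)))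
  where
  at : ∀ {w} → w ∈ children F v → lookup c w ≡ lookup c′ w
  at {w} mw = agree w (any-true⁺ (λ u → touched k F u w) mw (cong (_∨ below k F w w) (==-refl w)))
  map-cong-∈ : ∀ ws → (∀ {w} → w ∈ ws → lookup c w ≡ lookup c′ w) → map (lookup c) ws ≡ map (lookup c′) ws
  map-cong-∈ []       h = refl
  map-cong-∈ (w ∷ ws) h = cong₂ _∷_ (h (here refl)) (map-cong-∈ ws (h ∘ there))

mutual
  -- Only the number `m` of permitted colours enters, never the colours themselves. Below a non-root
  -- vertex it is `pred κ`, whatever the colour of the parent edge.
  weightBelow : ℕ → ℕ → Forest n → Fin n → ℕ → ℚ
  weightBelow κ zero    F v m = 1ℚ
  weightBelow κ (suc k) F v m = frac 1 (perm m (length (children F v))) * weightList κ k F (children F v)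

  weightList : ℕ → ℕ → Forest n → List (Fin n) → ℚ
  weightList κ k F []       = 1ℚ
  weightList κ k F (w ∷ ws) = weightBelow κ k F w (pred κ) * weightList κ k F ws

module _ {κ : ℕ} {F : Forest n} (rk : Ranked F) (deg≤ : ∀ v → deg F v ≤ κ) where

  allowed-just : (a : Fin κ) → length (allowed (just a)) ≡ pred κ
  allowed-just a = cong pred (trans (ℕ.+-comm 1 _) (length-allowed (just a)))

  allowed-nothing : length (allowed {κ} nothing) ≡ κ
  allowed-nothing = trans (sym (ℕ.+-identityʳ _)) (length-allowed nothing)

  children≤ : ∀ {w y} (a : Fin κ) → lookup F w ≡ just y → length (children F w) ≤ length (allowed (just a))
  children≤ {w} a e = s≤s⁻¹ (subst₂ _≤_
    (trans (cong (λ b → length (children F w) + (if b then 0 else 1)) (isRoot-just {F = F} e)) (ℕ.+-comm _ 1))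
    (sym (trans (ℕ.+-comm 1 _) (length-allowed (just a)))) (deg≤ w))

  not-below-self : ∀ k w → below k F w w ≡ false
  not-below-self k w with below k F w w in eq
  ... | false = refl
  ... | true  = let (_ , e , a) = below⇒Anc k {F} eq in
    ⊥-elim (ℕ.<-irrefl refl (ℕ.<-≤-trans (rank-par rk e) (Anc-rank rk a)))

  mutual
    -- Different arrangements give the children different colours, so the drawn arrangement can be
    -- recovered from the result. The bound on the number of children keeps the list of arrangements
    -- nonempty, as total mass 1 requires.
    sampleBelow-flat : ∀ k v (f : Maybe (Fin κ)) → length (children F v) ≤ length (allowed f) → ∀ c →
      Flat (sampleBelow k F v f c) (weightBelow κ k F v (length (allowed f)))
           (λ c′ → Off (below k F v) c c′ × Below k F v f c′)
    sampleBelow-flat zero v f le c = Flat-⇔ (Flat-return c) λ c′ →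
      mk⇔ (λ { refl → (λ _ _ → refl) , tt }) (λ { (o , _) → lookup-≗ (λ x → sym (o x refl)) })
    sampleBelow-flat (suc k) v f le c = Flat-⇔
      (Flat-bind uni (λ {cols} m → sampleList-flat k ch cols
          (sym (proj₁ (∈-arrangements⁻ ua _ m))) (children-unique F v) (children-separated rk v)
          (All.tabulate (λ m → v , ∈-children⁻ F m)) c)
        (λ { _ _ (_ , eq , _) (_ , eq′ , _) → map-injective just-injective (trans (sym eq) eq′) }))
      λ c′ → mk⇔ (λ { (cols , m , o , eq , al) → o , (cols , m , eq) , al })
                  (λ { (o , (cols , m , eq) , al) → cols , m , o , eq , al })
      where
      ch : List (Fin n)
      ch = children F v
      ua : Unique (allowed f)
      ua = UP.filter⁺ (T? ∘ λ a → not (isJust= a f)) (UP.allFin⁺ κ)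
      len : length (arrangements (allowed f) (length ch)) ≡ perm (length (allowed f)) (length ch)
      len = length-arrangements (allowed f) (length ch)
      uni : Flat (uniform (arrangements (allowed f) (length ch))) (frac 1 (perm (length (allowed f)) (length ch)))
              (_∈ arrangements (allowed f) (length ch))
      uni = Flat-weight (cong (frac 1) len)
        (Flat-uniform (arrangements-unique ua (length ch)) (subst (0 <_) (sym len) (perm>0 le)))

    sampleList-flat : ∀ k ws (cols : List (Fin κ)) → length ws ≡ length cols → Unique ws → Separated F ws →
      All (λ w → ∃[ y ] lookup F w ≡ just y) ws → ∀ c →
      Flat (sampleList k F (zip ws cols) c) (weightList κ k F ws)
           (λ c′ → Off (touchedAny k F ws) c c′ × map (lookup c′) ws ≡ map just cols
                   × All (λ w → Below k F w (lookup c′ w) c′) ws)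
    sampleList-flat k [] [] len _ _ _ c = Flat-⇔ (Flat-return c) λ c′ →
      mk⇔ (λ { refl → (λ _ _ → refl) , refl , [] }) (λ { (o , _) → lookup-≗ (λ x → sym (o x refl)) })
    sampleList-flat k (w ∷ ws) (a ∷ cols) len (fresh ∷ u) sp ((y , e) ∷ es) c = Flat-⇔
      (seq {c = c} {C = λ c′ → lookup c′ w ≡ just a × Below k F w (lookup c′ w) c′} first
        (sampleList-flat k ws cols (ℕ.suc-injective len) u (λ mv mw → sp (there mv) (there mw)) es)
        disj local)
      λ c′ → mk⇔ (λ { (o , (eq , b) , eqs , bs) → o , cong₂ _∷_ eq eqs , b ∷ bs })
                  (λ { (o , eqs , b ∷ bs) → o , (proj₁ (∷-injective eqs) , b) , proj₂ (∷-injective eqs) , bs })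
      where
      -- The assignment at `w` is absorbed into the region: `w` is not strictly below itself, so its
      -- new colour survives the recursive call.
      first : Flat (sampleBelow k F w (just a) (c [ w ]≔ just a)) (weightBelow κ k F w (pred κ))
        (λ c′ → Off (touched k F w) c c′ × (lookup c′ w ≡ just a × Below k F w (lookup c′ w) c′))
      first = Flat-⇔ (Flat-weight (cong (weightBelow κ k F w) (allowed-just a))
                        (sampleBelow-flat k w (just a) (children≤ a e) (c [ w ]≔ just a)))
        λ c′ → mk⇔ (to c′) (from c′)
        where
        to : ∀ c′ → Off (below k F w) (c [ w ]≔ just a) c′ × Below k F w (just a) c′ →
          Off (touched k F w) c c′ × (lookup c′ w ≡ just a × Below k F w (lookup c′ w) c′)
        to c′ (o , b) = off , at , subst (λ z → Below k F w z c′) (sym at) b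
          where
          at : lookup c′ w ≡ just a
          at = trans (o w (not-below-self k w)) (lookup∘update w c (just a))
          off : Off (touched k F w) c c′
          off x eq with w ≟F x
          ... | no ne = trans (o x eq) (lookup∘update′ (≢-sym ne) c (just a))
        from : ∀ c′ → Off (touched k F w) c c′ × (lookup c′ w ≡ just a × Below k F w (lookup c′ w) c′) →
          Off (below k F w) (c [ w ]≔ just a) c′ × Below k F w (just a) c′
        from c′ (o , at , b) = off , subst (λ z → Below k F w z c′) at b
          where
          off : Off (below k F w) (c [ w ]≔ just a) c′
          off x eq with x ≟F w
          ... | yes refl = trans at (sym (lookup∘update w c (just a)))
          ... | no ne    = trans (o x (trans (cong (_∨ below k F w x) (dec-false (w ≟F x) (≢-sym ne))) eq))
                             (sym (lookup∘update′ ne c (just a)))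

      disj : ∀ x → touched k F w x ≡ true → touchedAny k F ws x ≡ false
      disj x t = any-false (λ v → touched k F v x) ws λ m t′ →
        All.lookup fresh m (sp (here refl) (there m) (touched⇒Anc k t) (touched⇒Anc k t′))

      local : ∀ {c₁ c₂} → (∀ x → touched k F w x ≡ true → lookup c₁ x ≡ lookup c₂ x) →
        lookup c₁ w ≡ just a × Below k F w (lookup c₁ w) c₁ → lookup c₂ w ≡ just a × Below k F w (lookup c₂ w) c₂
      local {c₁} {c₂} agree (eq , b) = trans (sym at) eq ,
        subst (λ z → Below k F w z c₂) at (Below-local k (λ x t → agree x (below⇒touched x t)) b)
        where
        at : lookup c₁ w ≡ lookup c₂ w
        at = agree w (cong (_∨ below k F w w) (==-refl w))
        below⇒touched : ∀ x → below k F w x ≡ true → touched k F w x ≡ true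
        below⇒touched x t with w == x
        ... | true  = refl
        ... | false = t

  -- Generalised over the accumulator of the `foldl`: `R` is the region already written and `C` the
  -- condition already secured there.
  sampleRoots-flat : ∀ k vs {d : Dist (Coloring n κ)} {w} {R : Region n} {C : Coloring n κ → Set} →
    Flat d w (λ c′ → Off R emptyC c′ × C c′) → Unique vs → Separated F vs →
    (∀ {v} → v ∈ vs → ∀ x → R x ≡ true → below k F v x ≡ false) →
    (∀ {c₁ c₂} → (∀ x → R x ≡ true → lookup c₁ x ≡ lookup c₂ x) → C c₁ → C c₂) →
    ∃[ w′ ] Flat (foldl (λ d v → d >>= sampleBelow k F v nothing) d vs) w′
      (λ c′ → Off (λ x → R x ∨ any (λ v → below k F v x) vs) emptyC c′ × C c′ × All (λ v → Below k F v nothing c′) vs)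
  sampleRoots-flat k [] {w = w} {R} fd _ _ _ _ = w , Flat-⇔ fd λ c′ →
    mk⇔ (λ { (o , cc) → (λ x eq → o x (trans (sym (∨-identityʳ (R x))) eq)) , cc , [] })
        (λ { (o , cc , _) → (λ x eq → o x (trans (∨-identityʳ (R x)) eq)) , cc })
  sampleRoots-flat k (v ∷ vs) {R = R} {C} fd (fresh ∷ u) sp disj local =
    let (w′ , fl) = sampleRoots-flat k vs
          (seq {c = emptyC} fd (sampleBelow-flat k v nothing (ℕ.≤-trans (ℕ.≤-trans (ℕ.m≤m+n _ _) (deg≤ v)) (ℕ.≤-reflexive (sym allowed-nothing)))) (disj (here refl)) local)
          u (λ mv mw → sp (there mv) (there mw)) disj′
          (λ agree (cc , b) → local (λ x r → agree x (cong (_∨ below k F v x) r)) cc ,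
            Below-local k (λ x b → agree x (trans (cong (R x ∨_) b) (∨-zeroʳ (R x)))) b)
    in w′ , Flat-⇔ fl λ c′ →
      mk⇔ (λ { (o , (cc , b) , bs) → (λ x eq → o x (trans (∨-assoc (R x) _ _) eq)) , cc , b ∷ bs })
          (λ { (o , cc , b ∷ bs) → (λ x eq → o x (trans (sym (∨-assoc (R x) _ _)) eq)) , (cc , b) , bs })
    where
    disj′ : ∀ {v′} → v′ ∈ vs → ∀ x → R x ∨ below k F v x ≡ true → below k F v′ x ≡ false
    disj′ {v′} m x eq with R x in r | below k F v′ x in b′
    ... | _     | false = refl
    ... | true  | true  = trans (sym b′) (disj (there m) x r)
    ... | false | true  = let (_ , e , a) = below⇒Anc k {F} eq ; (_ , e′ , a′) = below⇒Anc k {F} b′ in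
      ⊥-elim (All.lookup fresh m (sp (here refl) (there m) (up e a) (up e′ a′)))

  -- Local sampling conditions and proper colourings

  module _ {c : Coloring n κ} where

    Good⇒ : ∀ {v f} → Good F v f c →
      (∀ {x} → lookup F x ≡ just v → ∃[ a ] lookup c x ≡ just a × f ≢ just a)
      × (∀ {x x′} → lookup F x ≡ just v → lookup F x′ ≡ just v → lookup c x ≡ lookup c x′ → x ≡ x′)
    Good⇒ {v} {f} (cols , m , eq) =
      (λ e → let (a , ma , eqa) = ∈-map⁻ just (subst (_ ∈_) eq (∈-map⁺ (lookup c) (∈-children⁺ F e))) in
        a , eqa , Equivalence.to ∈-allowed (All.lookup (proj₂ (proj₂ arr)) ma)) ,
      (λ e e′ → unique-map⁻ (lookup c) (subst Unique (sym eq) (UP.map⁺ just-injective (proj₁ (proj₂ arr))))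
        (∈-children⁺ F e) (∈-children⁺ F e′))
      where
      arr : Arrangement (allowed f) (length (children F v)) cols
      arr = ∈-arrangements⁻ (UP.filter⁺ (T? ∘ λ a → not (isJust= a f)) (UP.allFin⁺ κ)) _ m

    Proper⇒Good : Proper F c → ∀ v → Good F v (lookup c v) c
    Proper⇒Good pr v = cols , ∈-arrangements⁺ (UP.filter⁺ (T? ∘ λ a → not (isJust= a (lookup c v))) (UP.allFin⁺ κ)) _
        ( trans (sym (length-map just cols)) (trans (cong length (sym eq)) (length-map (lookup c) (children F v)))
        , UP.map⁻ {f = just} (subst Unique eq (unique-map (lookup c) (children-unique F v)
            (λ m m′ → sibling pr (∈-children⁻ F m) (∈-children⁻ F m′))))
        , All.tabulate (λ {a} m → Equivalence.from ∈-allowed (λ cv →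
            let (w , mw , eqw) = ∈-map⁻ (lookup c) (subst (just a ∈_) (sym eq) (∈-map⁺ just m)) in
            parent pr (∈-children⁻ F mw) (trans (sym eqw) (sym cv)))))
      , eq
      where
      strip : ∀ ws → (∀ {w} → w ∈ ws → ∃[ a ] lookup c w ≡ just a) → ∃[ cs ] map (lookup c) ws ≡ map just cs
      strip []       h = [] , refl
      strip (w ∷ ws) h = let (a , e) = h (here refl) ; (cs , es) = strip ws (h ∘ there) in a ∷ cs , cong₂ _∷_ e es
      cols : List (Fin κ)
      cols = proj₁ (strip (children F v) (λ m → edge pr (∈-children⁻ F m)))
      eq : map (lookup c) (children F v) ≡ map just cols
      eq = proj₂ (strip (children F v) (λ m → edge pr (∈-children⁻ F m)))

    Proper⇒Below : Proper F c → ∀ k v → Below k F v (lookup c v) c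
    Proper⇒Below pr zero    v = tt
    Proper⇒Below pr (suc k) v = Proper⇒Good pr v , All.tabulate (λ {w} _ → Proper⇒Below pr k w)

    -- Fuel k at v cannot run out when n ≤ rank v + k, as ranks increase downwards and stay below n.
    descend : ∀ k {v y f} → n ≤ rank rk v + k → Anc F v y → Below k F v f c → f ≡ lookup c v →
      ∃[ k′ ] n ≤ rank rk y + suc k′ × Below (suc k′) F y (lookup c y) c
              × (∀ {x} → lookup F x ≡ just y → below k F v x ≡ true)
    descend zero {v} le _ _ _ = ⊥-elim (ℕ.<-irrefl refl (ℕ.<-≤-trans (rank<n rk v) (ℕ.≤-trans le (ℕ.≤-reflexive (ℕ.+-identityʳ _)))))
    descend (suc k) le self b refl = k , le , b ,
      λ {x} e → any-true⁺ (λ w → touched k F w x) (∈-children⁺ F e) (cong (_∨ below k F x x) (==-refl x))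
    descend (suc k) {v} le (up e a) b refl =
      let (u , eu , au) = Anc-child a e
          mu = ∈-children⁺ F eu
          (k′ , le′ , b′ , reach) = descend k
            (ℕ.≤-trans (ℕ.≤-trans le (ℕ.≤-reflexive (ℕ.+-suc _ k))) (ℕ.+-monoˡ-≤ k (rank-par rk eu))) au (All.lookup (proj₂ b) mu) refl
      in k′ , le′ , b′ , λ {x} ex → any-true⁺ (λ w → touched k F w x) mu
           (trans (cong ((u == x) ∨_) (reach ex)) (∨-zeroʳ (u == x)))

  -- Every vertex hangs below some root within the available fuel, so the local conditions hold at
  -- all vertices and add up to properness. The region written is exactly the set of non-roots, and
  -- `emptyC` shows through at the roots.
  DF-flat : ∃[ w ] Flat (DF {n} {κ} F) w (Proper F)
  DF-flat with sampleRoots-flat n (roots F) {R = λ _ → false} {C = λ _ → ⊤}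
      (Flat-⇔ (Flat-return emptyC) λ c′ → mk⇔ (λ { refl → (λ _ _ → refl) , tt }) (λ { (o , _) → lookup-≗ (λ x → sym (o x refl)) }))
      (roots-unique F) (roots-separated F) (λ _ _ ()) (λ _ _ → tt)
  ... | (w , fl) = w , Flat-⇔ fl λ c → mk⇔ (to c) (from c)
    where
    covered : Region n
    covered x = any (λ v → below n F v x) (roots F)

    to : ∀ c → Off covered emptyC c × ⊤ × All (λ v → Below n F v nothing c) (roots F) → Proper F c
    to c (o , _ , al) = record
      { root    = at-root
      ; edge    = λ {x} {y} e → let (a , eq , _) = proj₁ (Good⇒ {c} {y} {lookup c y} (good y)) e in a , eq
      ; sibling = λ {x} {x′} {y} → proj₂ (Good⇒ {c} {y} {lookup c y} (good y))
      ; parent  = λ {x} {y} e eq → let (a , eqa , ne) = proj₁ (Good⇒ {c} {y} {lookup c y} (good y)) e in ne (trans (sym eq) eqa) }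
      where
      at-root : ∀ {x} → lookup F x ≡ nothing → lookup c x ≡ nothing
      at-root {x} e = trans
        (o x (any-false (λ v → below n F v x) (roots F) (λ {v} _ t → just≢nothing (proj₁ (proj₂ (below⇒Anc n {F} {v} t))) e)))
        (lookup-replicate x nothing)
      good : ∀ y → Good F y (lookup c y) c
      good y = let (v , ev , a) = find-root rk n y (rank<n rk y)
                   (_ , _ , (g , _) , _) = descend n (ℕ.m≤n+m n _) a (All.lookup al (∈-roots⁺ F ev)) (sym (at-root ev))
               in g

    from : ∀ c → Proper F c → Off covered emptyC c × ⊤ × All (λ v → Below n F v nothing c) (roots F)
    from c pr = off , tt , All.tabulate at
      where
      at : ∀ {v} → v ∈ roots F → Below n F v nothing c
      at {v} m = subst (λ z → Below n F v z c) (root pr (∈-roots⁻ F m)) (Proper⇒Below pr n v)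
      off : Off covered emptyC c
      off x eq with lookup F x in e
      ... | nothing = trans (root pr e) (sym (lookup-replicate x nothing))
      ... | just y  with () ← trans (sym eq) (let (v , ev , a) = find-root rk n y (rank<n rk y) in
              any-true⁺ (λ v → below n F v x) (∈-roots⁺ F ev)
                (proj₂ (proj₂ (proj₂ (descend n (ℕ.m≤n+m n _) a (Proper⇒Below pr n v) refl))) e))

-- Kempe exchanges

isAB : Fin κ → Fin κ → Maybe (Fin κ) → Bool
isAB a b m = does (≡-dec _≟F_ m (just a)) ∨ does (≡-dec _≟F_ m (just b))

τ : Fin κ → Fin κ → Maybe (Fin κ) → Maybe (Fin κ)
τ a b m = if does (≡-dec _≟F_ m (just a)) then just b else (if does (≡-dec _≟F_ m (just b)) then just a else m)

module _ (a b : Fin κ) where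

  τ-a : τ a b (just a) ≡ just b
  τ-a rewrite dec-true (a ≟F a) refl = refl

  τ-b : τ a b (just b) ≡ just a
  τ-b with b ≟F a
  ... | yes eq = cong just eq
  ... | no _ rewrite dec-true (b ≟F b) refl = refl

  τ-other : ∀ {m} → m ≢ just a → m ≢ just b → τ a b m ≡ m
  τ-other {m} ma mb rewrite dec-false (≡-dec _≟F_ m (just a)) ma | dec-false (≡-dec _≟F_ m (just b)) mb = refl

  isAB-a : isAB a b (just a) ≡ true
  isAB-a rewrite dec-true (a ≟F a) refl = refl

  isAB-b : isAB a b (just b) ≡ true
  isAB-b with b ≟F a
  ... | yes _ = refl
  ... | no _  = dec-true (b ≟F b) refl

  isAB-other : ∀ {m} → m ≢ just a → m ≢ just b → isAB a b m ≡ false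
  isAB-other {m} ma mb rewrite dec-false (≡-dec _≟F_ m (just a)) ma | dec-false (≡-dec _≟F_ m (just b)) mb = refl

  data View : Maybe (Fin κ) → Set where
    is-a  : View (just a)
    is-b  : View (just b)
    other : ∀ {m} → m ≢ just a → m ≢ just b → View m

  view : ∀ m → View m
  view m with ≡-dec _≟F_ m (just a) | ≡-dec _≟F_ m (just b)
  ... | yes refl | _        = is-a
  ... | no _     | yes refl = is-b
  ... | no ma    | no mb    = other ma mb

  τ-involutive : ∀ m → τ a b (τ a b m) ≡ m
  τ-involutive m with view m
  ... | is-a        = trans (cong (τ a b) τ-a) τ-b
  ... | is-b        = trans (cong (τ a b) τ-b) τ-a
  ... | other ma mb = trans (cong (τ a b) (τ-other ma mb)) (τ-other ma mb)

  τ-injective : ∀ {m m′} → τ a b m ≡ τ a b m′ → m ≡ m′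
  τ-injective {m} {m′} eq = trans (sym (τ-involutive m)) (trans (cong (τ a b) eq) (τ-involutive m′))

  isAB-τ : ∀ m → isAB a b (τ a b m) ≡ isAB a b m
  isAB-τ m with view m
  ... | is-a        = trans (cong (isAB a b) τ-a) (trans isAB-b (sym isAB-a))
  ... | is-b        = trans (cong (isAB a b) τ-b) (trans isAB-a (sym isAB-b))
  ... | other ma mb = cong (isAB a b) (τ-other ma mb)

  τ-fixes : ∀ m → isAB a b m ≡ false → τ a b m ≡ m
  τ-fixes m eq with view m
  ... | is-a with () ← trans (sym isAB-a) eq
  ... | is-b with () ← trans (sym isAB-b) eq
  ... | other ma mb = τ-other ma mb

τ-sym : (a b : Fin κ) → ∀ m → τ a b m ≡ τ b a m
τ-sym a b m with view a b m
... | is-a        = trans (τ-a a b) (sym (τ-b b a))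
... | is-b        = trans (τ-b a b) (sym (τ-a b a))
... | other ma mb = trans (τ-other a b ma mb) (sym (τ-other b a mb ma))

τ-just : (a b : Fin κ) → ∀ {m} → ∃[ d ] m ≡ just d → ∃[ d ] τ a b m ≡ just d
τ-just a b {m} (d , eq) with view a b m
... | is-a        = b , τ-a a b
... | is-b        = a , τ-b a b
... | other ma mb = d , trans (τ-other a b ma mb) eq

τ-if : (a b : Fin κ) → Bool → Maybe (Fin κ) → Maybe (Fin κ)
τ-if a b s m = if s then τ a b m else m

τ-if-sym : (a b : Fin κ) → ∀ s m → τ-if a b s m ≡ τ-if b a s m
τ-if-sym a b true  m = τ-sym a b m
τ-if-sym a b false m = refl

-- c′ arises from c by exchanging a and b on the bichromatic path that starts with the parent edge
-- of w and descends from w.  Since the condition on the vertex set S only depends on which edges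
-- have a colour in {a , b}, the relation is symmetric in c and c′.
record Kempe (F : Forest n) (w : Fin n) (a b : Fin κ) (c c′ : Coloring n κ) : Set where
  field
    S       : Fin n → Bool
    start   : S w ≡ true
    grow    : ∀ {x y} → x ≢ w → lookup F x ≡ just y → S x ≡ S y ∧ isAB a b (lookup c x)
    stop    : ∀ {x} → x ≢ w → lookup F x ≡ nothing → S x ≡ false
    swapped : ∀ x → lookup c′ x ≡ τ-if a b (S x) (lookup c x)
open Kempe

module _ {F : Forest n} {w : Fin n} {a b : Fin κ} {c c′ : Coloring n κ} (K : Kempe F w a b c c′) where

  Kempe-sym : Kempe F w a b c′ c
  Kempe-sym = record
    { S = S K ; start = start K ; stop = stop K
    ; grow = λ {x} {y} ne e → trans (grow K ne e) (cong (S K y ∧_) (sym (same x)))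
    ; swapped = λ x → undo x (S K x) refl }
    where
    same : ∀ x → isAB a b (lookup c′ x) ≡ isAB a b (lookup c x)
    same x with S K x | swapped K x
    ... | true  | eq = trans (cong (isAB a b) eq) (isAB-τ a b (lookup c x))
    ... | false | eq = cong (isAB a b) eq
    undo : ∀ x s → S K x ≡ s → lookup c x ≡ τ-if a b s (lookup c′ x)
    undo x true  s = sym (trans (cong (τ a b) (trans (swapped K x) (cong (λ z → τ-if a b z (lookup c x)) s))) (τ-involutive a b (lookup c x)))
    undo x false s = sym (trans (swapped K x) (cong (λ z → τ-if a b z (lookup c x)) s))

  Kempe-flip : Kempe F w b a c c′
  Kempe-flip = record
    { S = S K ; start = start K ; stop = stop K
    ; grow = λ {x} {y} ne e → trans (grow K ne e) (cong (S K y ∧_) (∨-comm (does (≡-dec _≟F_ (lookup c x) (just a))) _))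
    ; swapped = λ x → trans (swapped K x) (τ-if-sym a b (S K x) (lookup c x)) }

  -- A root other than `w` lies outside `S`, so its entry does not influence the exchange. This
  -- carries an exchange over between colourings with and without the colour of the edge above `r`.
  Kempe-frame : {r : Fin n} (m : Maybe (Fin κ)) → lookup F r ≡ nothing → r ≢ w → Kempe F w a b (c [ r ]≔ m) (c′ [ r ]≔ m)
  Kempe-frame {r} m er ne = record
    { S = S K ; start = start K ; stop = stop K
    ; grow = λ {x} {y} ne e → trans (grow K ne e) (cong (λ z → S K y ∧ isAB a b z)
        (sym (lookup∘update′ (λ { refl → just≢nothing e er }) c m)))
    ; swapped = sw }
    where
    sw : ∀ x → lookup (c′ [ r ]≔ m) x ≡ τ-if a b (S K x) (lookup (c [ r ]≔ m) x)
    sw x with x ≟F r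
    ... | yes refl rewrite lookup∘update r c m | lookup∘update r c′ m | stop K ne er = refl
    ... | no x≢r   rewrite lookup∘update′ x≢r c m | lookup∘update′ x≢r c′ m = swapped K x

  Kempe-start : lookup c w ≡ just a → lookup c′ w ≡ just b
  Kempe-start eq = trans (swapped K w) (trans (cong₂ (τ-if a b) (start K) eq) (τ-a a b))

  Kempe-off : ∀ {x} → S K x ≡ false → lookup c′ x ≡ lookup c x
  Kempe-off {x} s = trans (swapped K x) (cong (λ z → τ-if a b z (lookup c x)) s)

  -- `S x` and `S y` can differ only where the colour lies outside the exchanged pair, and there `τ`
  -- is the identity. Hence one injective map acts on `y` and all its children other than `w`, which
  -- is what preserves properness.
  Kempe-child : ∀ {x y} → x ≢ w → lookup F x ≡ just y → lookup c′ x ≡ τ-if a b (S K y) (lookup c x)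
  Kempe-child {x} {y} ne e = trans (swapped K x) (trans (cong (λ s → τ-if a b s (lookup c x)) (grow K ne e)) (absorb (S K y)))
    where
    absorb : ∀ s → τ-if a b (s ∧ isAB a b (lookup c x)) (lookup c x) ≡ τ-if a b s (lookup c x)
    absorb false = refl
    absorb true with isAB a b (lookup c x) in eq
    ... | true  = refl
    ... | false = sym (τ-fixes a b (lookup c x) eq)

  Kempe-child-off : ∀ {x y} → x ≢ w → lookup F x ≡ just y → S K y ≡ false → lookup c′ x ≡ lookup c x
  Kempe-child-off {x} ne e s = trans (Kempe-child ne e) (cong (λ z → τ-if a b z (lookup c x)) s)

  τ-if-injective : ∀ s {m m′} → τ-if a b s m ≡ τ-if a b s m′ → m ≡ m′
  τ-if-injective true  = τ-injective a b
  τ-if-injective false eq = eq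

  τ-if-just : ∀ s {m} → ∃[ d ] m ≡ just d → ∃[ d ] τ-if a b s m ≡ just d
  τ-if-just true  = τ-just a b
  τ-if-just false j = j

  -- The set spreads only downwards from `w`: any other member has its parent in the set, and
  -- climbing from below the rank of `w` would end at a root, which `stop` excludes.
  Kempe-rank : (rk : Ranked F) → ∀ {x} → rank rk x < rank rk w → S K x ≡ false
  Kempe-rank rk {x} lt = go (suc (rank rk x)) ℕ.≤-refl lt
    where
    go : ∀ k {x} → rank rk x < k → rank rk x < rank rk w → S K x ≡ false
    go (suc k) {x} le lt with lookup F x in e
    ... | nothing = stop K (λ { refl → ℕ.<-irrefl refl lt }) e
    ... | just y  = trans (grow K (λ { refl → ℕ.<-irrefl refl lt }) e)
      (cong (_∧ isAB a b (lookup c x)) (go k (ℕ.<-≤-trans (rank-par rk e) (s≤s⁻¹ le)) (ℕ.<-trans (rank-par rk e) lt)))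

  -- Below `w` the common injective map does the work. The critical place is the upper end `v`,
  -- where only the edge to `w` changes; the last two hypotheses say that its new colour `b` is free
  -- there.
  Kempe-proper : {v : Fin n} → Ranked F → Proper F c → lookup F w ≡ just v → lookup c w ≡ just a → lookup c v ≢ just b →
    (∀ {x} → lookup F x ≡ just v → lookup c x ≢ just b) → Proper F c′
  Kempe-proper {v} rk pr ev ca nv nc = record
    { root    = λ {x} e → trans (Kempe-off (stop K (λ { refl → just≢nothing ev e }) e)) (root pr e)
    ; edge    = λ {x} e → subst (λ z → ∃[ d ] z ≡ just d) (sym (swapped K x)) (τ-if-just (S K x) (edge pr e))
    ; sibling = sib ; parent = par }
    where
    v-off : S K v ≡ false
    v-off = Kempe-rank rk (rank-par rk ev)
    cw : lookup c′ w ≡ just b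
    cw = Kempe-start ca
    sib : ∀ {x x′ y} → lookup F x ≡ just y → lookup F x′ ≡ just y → lookup c′ x ≡ lookup c′ x′ → x ≡ x′
    sib {x} {x′} {y} e e′ eq with x ≟F w | x′ ≟F w
    ... | yes refl | yes refl = refl
    ... | yes refl | no ne with refl ← trans (sym ev) e =
      ⊥-elim (nc e′ (trans (sym (Kempe-child-off ne e′ v-off)) (trans (sym eq) cw)))
    ... | no ne | yes refl with refl ← trans (sym ev) e′ =
      ⊥-elim (nc e (trans (sym (Kempe-child-off ne e v-off)) (trans eq cw)))
    ... | no ne | no ne′ = sibling pr e e′ (τ-if-injective (S K y)
      (trans (sym (Kempe-child ne e)) (trans eq (Kempe-child ne′ e′))))
    par : ∀ {x y} → lookup F x ≡ just y → lookup c′ x ≢ lookup c′ y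
    par {x} {y} e eq with x ≟F w
    ... | yes refl with refl ← trans (sym ev) e = nv (trans (sym (Kempe-off v-off)) (trans (sym eq) cw))
    ... | no ne = parent pr e (τ-if-injective (S K y) (trans (sym (Kempe-child ne e)) (trans eq (swapped K y))))

-- `start`, `grow` and `stop` determine `S` by induction on the rank. An exchange read backwards
-- therefore leads to no other colouring.
Kempe-functional : {F : Forest n} → Ranked F → {w : Fin n} {a b : Fin κ} {c c₁ c₂ : Coloring n κ} →
  Kempe F w a b c c₁ → Kempe F w a b c c₂ → c₁ ≡ c₂
Kempe-functional {F = F} rk {w} {a} {b} {c} K₁ K₂ = lookup-≗ λ x →
  trans (swapped K₁ x) (trans (cong (λ s → τ-if a b s (lookup c x)) (same (suc (rank rk x)) ℕ.≤-refl)) (sym (swapped K₂ x)))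
  where
  same : ∀ k {x} → rank rk x < k → S K₁ x ≡ S K₂ x
  same (suc k) {x} lt with x ≟F w | lookup F x in e
  ... | yes refl | _       = trans (start K₁) (sym (start K₂))
  ... | no ne    | nothing = trans (stop K₁ ne e) (sym (stop K₂ ne e))
  ... | no ne    | just y  = trans (grow K₁ ne e) (trans
    (cong (_∧ isAB a b (lookup c x)) (same k (ℕ.<-≤-trans (rank-par rk e) (s≤s⁻¹ lt)))) (sym (grow K₂ ne e)))

-- Local properness below w is all that survives along the recursion, since the edge at w has just been recoloured.
fixForbidden-Kempe : {F : Forest n} (rk : Ranked F) → ∀ k {w : Fin n} {a b : Fin κ} {c} → n ≤ rank rk w + k → a ≢ b →
  lookup c w ≡ just a →
  (∀ {x x′ y} → rank rk w ≤ rank rk y → lookup F x ≡ just y → lookup F x′ ≡ just y → lookup c x ≡ lookup c x′ → x ≡ x′) →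
  (∀ {x y} → rank rk w ≤ rank rk y → lookup F x ≡ just y → lookup c x ≢ lookup c y) →
  ∃[ c′ ] fixForbidden k F w a b (c [ w ]≔ just b) ≡ return c′ × Kempe F w a b c c′
fixForbidden-Kempe rk zero {w} le _ _ _ _ =
  ⊥-elim (ℕ.<-irrefl refl (ℕ.<-≤-trans (rank<n rk w) (ℕ.≤-trans le (ℕ.≤-reflexive (ℕ.+-identityʳ _)))))
fixForbidden-Kempe {n} {κ} {F} rk (suc k) {w} {a} {b} {c} le a≢b ca sib par with childWithColor F (c [ w ]≔ just b) w b in cw
... | nothing = c₀ , refl , record
  { S = w ==_ ; start = ==-refl w
  ; grow = λ {x} {y} ne e → trans (dec-false (w ≟F x) (≢-sym ne)) (sym (ends ne e))
  ; stop = λ ne _ → dec-false (w ≟F _) (≢-sym ne)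
  ; swapped = sw }
  where
  c₀ : Coloring n κ
  c₀ = c [ w ]≔ just b
  -- The path stops at `w`: a child coloured `a` would clash with the old colour of `w`, and the
  -- search has found none coloured `b`.
  ends : ∀ {x y} → x ≢ w → lookup F x ≡ just y → (w == y) ∧ isAB a b (lookup c x) ≡ false
  ends {x} {y} ne e with w ≟F y
  ... | no _     = refl
  ... | yes refl = isAB-other a b
    (λ eq → par ℕ.≤-refl e (trans eq (sym ca)))
    (λ eq → childWithColor-nothing {F = F} {c₀} {w} {x} {b} cw e (trans (lookup∘update′ ne c (just b)) eq))
  sw : ∀ x → lookup c₀ x ≡ τ-if a b (w == x) (lookup c x)
  sw x with w ≟F x
  ... | yes refl = trans (lookup∘update w c (just b)) (sym (trans (cong (τ a b) ca) (τ-a a b)))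
  ... | no ne    = lookup∘update′ (≢-sym ne) c (just b)
... | just w₁ with childWithColor-just {F = F} {c [ w ]≔ just b} {w} {w₁} {b} cw
...   | (e₁ , c₁) with fixForbidden-Kempe rk k {w₁} {b} {a} {c [ w ]≔ just b}
          (ℕ.≤-trans (ℕ.≤-trans le (ℕ.≤-reflexive (ℕ.+-suc _ k))) (ℕ.+-monoˡ-≤ k (rank-par rk e₁))) (≢-sym a≢b) c₁
          (λ ly e e′ eq → sib (w≤ ly) e e′ (trans (sym (upd (under e ly))) (trans eq (upd (under e′ ly)))))
          (λ ly e eq → par (w≤ ly) e (trans (sym (upd (under e ly))) (trans eq (upd (ℕ.<-≤-trans (rank-par rk e₁) ly)))))
  where
  w≤ : ∀ {y} → rank rk w₁ ≤ rank rk y → rank rk w ≤ rank rk y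
  w≤ = ℕ.≤-trans (ℕ.<⇒≤ (rank-par rk e₁))
  upd : ∀ {x} → rank rk w < rank rk x → lookup (c [ w ]≔ just b) x ≡ lookup c x
  upd lt = lookup∘update′ (λ { refl → ℕ.<-irrefl refl lt }) c (just b)
  under : ∀ {x y} → lookup F x ≡ just y → rank rk w₁ ≤ rank rk y → rank rk w < rank rk x
  under e ly = ℕ.<-≤-trans (rank-par rk e₁) (ℕ.≤-trans ly (ℕ.<⇒≤ (rank-par rk e)))
...     | (c′ , eq , K) = c′ , eq , record
  { S = S′ ; start = cong (_∨ S K w) (==-refl w)
  ; grow = grow′
  ; stop = λ {x} ne e → trans (cong (_∨ S K x) (dec-false (w ≟F x) (≢-sym ne))) (stop K (λ { refl → just≢nothing e₁ e }) e)
  ; swapped = sw }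
  where
  -- The recursive call yields the path from `w₁` with the two colours in opposite roles; prepending
  -- `w` gives the whole path.
  S′ : Fin n → Bool
  S′ x = (w == x) ∨ S K x
  S′-other : ∀ {x} → x ≢ w → S′ x ≡ S K x
  S′-other {x} ne = cong (_∨ S K x) (dec-false (w ≟F x) (≢-sym ne))
  w-off : S K w ≡ false
  w-off = Kempe-rank K rk (rank-par rk e₁)
  w₁≢w : w₁ ≢ w
  w₁≢w refl = ℕ.<-irrefl refl (rank-par rk e₁)
  cw₁ : lookup c w₁ ≡ just b
  cw₁ = trans (sym (lookup∘update′ w₁≢w c (just b))) c₁
  -- Below `w` the path continues through `w₁` only: any other child of `w` has neither the colour
  -- `a` of `w` nor the colour `b` of its sibling `w₁`. Elsewhere the rule is inherited from `K`.
  grow′ : ∀ {x y} → x ≢ w → lookup F x ≡ just y → S′ x ≡ S′ y ∧ isAB a b (lookup c x)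
  grow′ {x} {y} ne e with x ≟F w₁
  ... | yes refl with refl ← trans (sym e) e₁ = trans (S′-other ne) (trans (start K)
    (sym (cong₂ _∧_ (cong (_∨ S K y) (==-refl y)) (trans (cong (isAB a b) cw₁) (isAB-b a b)))))
  ... | no ne₁ with y ≟F w
  ...   | yes refl = trans (S′-other ne) (trans (grow K ne₁ e) (trans (cong (_∧ _) w-off)
    (sym (cong₂ _∧_ (cong (_∨ S K y) (==-refl y)) (isAB-other a b (λ q → par ℕ.≤-refl e (trans q (sym ca))) (λ q → ne₁ (sib ℕ.≤-refl e e₁ (trans q (sym cw₁)))))))))
  ...   | no y≢w = trans (S′-other ne) (trans (grow K ne₁ e) (cong₂ _∧_ (sym (S′-other y≢w))
    (trans (cong (isAB b a) (lookup∘update′ ne c (just b))) (∨-comm (does (≡-dec _≟F_ (lookup c x) (just b))) _))))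
  sw : ∀ x → lookup c′ x ≡ τ-if a b (S′ x) (lookup c x)
  sw x with x ≟F w
  ... | yes refl = trans (Kempe-off K w-off) (trans (lookup∘update x c (just b))
    (sym (trans (cong₂ (τ-if a b) (cong (_∨ S K x) (==-refl x)) ca) (τ-a a b))))
  ... | no ne = trans (swapped K x) (trans (cong (τ-if b a (S K x)) (lookup∘update′ ne c (just b)))
    (trans (τ-if-sym b a (S K x) (lookup c x)) (cong (λ s → τ-if a b s (lookup c x)) (sym (S′-other ne)))))

-- Access to the continuations inside `step`

bind-cong : (d : Dist A) {f g : A → Dist B} → (∀ a → f a ≡ g a) → d >>= f ≡ d >>= g
bind-cong []            eq = refl
bind-cong ((a , p) ∷ d) eq = cong₂ _++_ (cong (map _) (eq a)) (bind-cong d eq)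

-- The functions local to `step` cannot be named from outside. `insTail` and `recolor` are copies
-- that later lemmas can mention.
insTail : Forest n → Fin n → Fin κ → Coloring n κ → Maybe (Fin n) → Dist (Coloring n κ)
insTail     F r β c nothing  = return c
insTail {n} F r β c (just w) = uniform (avail F c r) >>= λ α → fixForbidden n F w β α (c [ w ]≔ just α)

step-ins : (F : Forest n) (p r : Fin n) (c : Coloring n κ) → let F′ = applyU F (ins p r) in
  step F (ins p r) c ≡ uniform (avail F c p) >>=
    λ β → insTail F′ r β (c [ r ]≔ just β) (childWithColor F′ (c [ r ]≔ just β) r β)
step-ins {n} {κ} F p r c = trans (proj₂ shape) (bind-cong (uniform (avail F c p)) tails)
  where
  F′ : Forest n
  F′ = applyU F (ins p r)
  -- Unification against `refl` fills the hole with the local continuation of `step`; afterwards it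
  -- is compared with the named copy value by value.
  shape : Σ (Fin κ → Dist (Coloring n κ)) λ f → step F (ins p r) c ≡ uniform (avail F c p) >>= f
  shape = _ , refl
  tails : ∀ β → proj₁ shape β ≡ insTail F′ r β (c [ r ]≔ just β) (childWithColor F′ (c [ r ]≔ just β) r β)
  tails β with childWithColor F′ (c [ r ]≔ just β) r β
  ... | nothing = refl
  ... | just w  = refl

recolor : Forest n → Fin κ → Coloring n κ → Fin n → Maybe (Fin κ) → Dist (Coloring n κ)
recolor     F α c w nothing  = return c
recolor {n} F α c w (just β) = fixForbidden n F w β α (c [ w ]≔ just α)

step-del : (F : Forest n) (p r : Fin n) {c : Coloring n κ} {α : Fin κ} → lookup c r ≡ just α →
  let F′ = applyU F (del p r) ; c₁ = c [ r ]≔ nothing in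
  step F (del p r) c ≡ (c₁ , frac (κ ∸ length (children F′ r)) κ)
    ∷ concatMap (λ w → scale (frac 1 κ) (recolor F′ α c₁ w (lookup c₁ w))) (children F′ r)
step-del {n} {κ} F p r {c} {α} eq =
  trans (proj₂ (shape eq)) (cong (_ ∷_) (concatMap-cong (λ w → cong (scale (frac 1 κ)) (same eq w)) (children F′ r)))
  where
  F′ : Forest n
  F′ = applyU F (del p r)
  c₁ : Coloring n κ
  c₁ = c [ r ]≔ nothing
  shape : lookup c r ≡ just α → Σ (Fin n → Dist (Coloring n κ)) λ f →
    step F (del p r) c ≡ (c₁ , frac (κ ∸ length (children F′ r)) κ) ∷ concatMap (λ w → scale (frac 1 κ) (f w)) (children F′ r)
  shape eq with lookup c r
  shape refl | just .α = _ , refl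
  same : (eq : lookup c r ≡ just α) → ∀ w → proj₁ (shape eq) w ≡ recolor F′ α c₁ w (lookup c₁ w)
  same eq w with lookup c r
  same refl w | just .α with lookup (c [ r ]≔ nothing) w
  ... | nothing = refl
  ... | just β  = refl

unused-cong : {us us′ : List (Maybe (Fin κ))} → (∀ {a} → just a ∈ us ⇔ just a ∈ us′) → unused us ≡ unused us′
unused-cong {us = us} {us′} iff = filterᵇ-cong same (allFin _)
  where
  same : ∀ a → isUnused us a ≡ isUnused us′ a
  same a with any (isJust= a) us in e | any (isJust= a) us′ in e′
  ... | true  | true  = refl
  ... | false | false = refl
  ... | true  | false = ⊥-elim (subst T e′ (Equivalence.from (any-isJust= us′) (Equivalence.to iff (Equivalence.to (any-isJust= us) (subst T (sym e) _)))))
  ... | false | true  = ⊥-elim (subst T e (Equivalence.from (any-isJust= us) (Equivalence.from iff (Equivalence.to (any-isJust= us′) (subst T (sym e′) _)))))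

∈-uniform⁻ : {xs : List A} {x : A} → x ∈ supp (uniform xs) → x ∈ xs
∈-uniform⁻ {xs = xs} = subst (_ ∈_) (supp-uniform xs)

∈-return⁻ : {d : Dist A} {x y : A} → d ≡ return y → x ∈ supp d → x ≡ y
∈-return⁻ refl (here eq) = eq

-- Adding and removing one edge

module Link (F₀ : Forest n) (p r : Fin n) (isolated : lookup F₀ r ≡ nothing)
  (rk : Ranked (F₀ [ r ]≔ just p)) (deg≤ : ∀ v → deg (F₀ [ r ]≔ just p) v ≤ κ) where

  F₁ : Forest n
  F₁ = F₀ [ r ]≔ just p

  at-r : lookup F₁ r ≡ just p
  at-r = lookup∘update r F₀ (just p)

  off-r : ∀ {x} → x ≢ r → lookup F₁ x ≡ lookup F₀ x
  off-r ne = lookup∘update′ ne F₀ (just p)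

  ≢r : ∀ {x y} → lookup F₀ x ≡ just y → x ≢ r
  ≢r e refl = just≢nothing e isolated

  lift : ∀ {x y} → lookup F₀ x ≡ just y → lookup F₁ x ≡ just y
  lift e = trans (off-r (≢r e)) e

  lower : ∀ {x y} → x ≢ r → lookup F₁ x ≡ just y → lookup F₀ x ≡ just y
  lower ne e = trans (sym (off-r ne)) e

  restore : F₁ [ r ]≔ nothing ≡ F₀
  restore = trans ([]≔-idempotent F₀ r) (trans (cong (F₀ [ r ]≔_) (sym isolated)) ([]≔-lookup F₀ r))

  rk₀ : Ranked F₀
  rk₀ = record { rank = rank rk ; rank-par = rank-par rk ∘ lift ; rank<n = rank<n rk }

  p<r : rank rk p < rank rk r
  p<r = rank-par rk at-r

  p≢r : p ≢ r
  p≢r eq = ℕ.<-irrefl (cong (rank rk) eq) p<r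

  isParent-off : ∀ {v w} → w ≢ r → isParent F₁ v w ≡ isParent F₀ v w
  isParent-off {v} {w} ne with lookup F₁ w | lookup F₀ w | off-r ne
  ... | just _  | _ | refl = refl
  ... | nothing | _ | refl = refl

  isParent-r₀ : ∀ v → isParent F₀ v r ≡ false
  isParent-r₀ v rewrite isolated = refl

  isParent-r₁ : ∀ v → isParent F₁ v r ≡ (p == v)
  isParent-r₁ v with lookup F₁ r | at-r
  ... | _ | refl = refl

  children-≡ : ∀ {v} → v ≢ p → children F₁ v ≡ children F₀ v
  children-≡ {v} ne = filterᵇ-cong same (allFin n)
    where
    same : ∀ w → isParent F₁ v w ≡ isParent F₀ v w
    same w with w ≟F r
    ... | no ne′   = isParent-off ne′
    ... | yes refl = trans (isParent-r₁ v) (trans (dec-false (p ≟F v) (≢-sym ne)) (sym (isParent-r₀ v)))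

  children-p : length (children F₁ p) ≡ suc (length (children F₀ p))
  children-p = filterᵇ-remove (isParent F₁ p) (isParent F₀ p) (UP.allFin⁺ n) (∈-allFin r)
    (trans (isParent-r₁ p) (==-refl p)) (isParent-r₀ p) (λ ne → sym (isParent-off ne))

  deg-p : deg F₁ p ≡ suc (deg F₀ p)
  deg-p = cong₂ (λ l b → l + (if b then 0 else 1)) children-p (same-root (lookup F₁ p) refl)
    where
    same-root : ∀ m → lookup F₁ p ≡ m → isRoot F₁ p ≡ isRoot F₀ p
    same-root nothing  e = trans (isRoot-nothing {F = F₁} e) (sym (isRoot-nothing {F = F₀} (trans (sym (off-r p≢r)) e)))
    same-root (just _) e = trans (isRoot-just {F = F₁} e) (sym (isRoot-just {F = F₀} (trans (sym (off-r p≢r)) e)))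

  -- `a` and `b` count the free colours at `p` and at `r` when the edge is absent. The degree bounds
  -- with the edge present make both positive.
  ℓ a b : ℕ
  ℓ = length (children F₀ r)
  a = κ ∸ deg F₀ p
  b = κ ∸ ℓ

  a>0 : 0 < a
  a>0 = ℕ.m<n⇒0<n∸m (subst (_≤ κ) deg-p (deg≤ p))

  ℓ<κ : ℓ < κ
  ℓ<κ = subst (_≤ κ) (trans (cong₂ (λ l b → length l + (if b then 0 else 1)) (children-≡ (≢-sym p≢r)) (isRoot-just {F = F₁} at-r)) (ℕ.+-comm ℓ 1)) (deg≤ r)

  b>0 : 0 < b
  b>0 = ℕ.m<n⇒0<n∸m ℓ<κ

  length-avail-p : {c : Coloring n κ} → Proper F₀ c → length (avail F₀ c p) ≡ a
  length-avail-p {c} pr = trans (sym (ℕ.m+n∸n≡m _ (deg F₀ p))) (cong (_∸ deg F₀ p) (length-avail pr p))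

  length-avail-r : {c : Coloring n κ} → Proper F₀ c → length (avail F₀ c r) ≡ b
  length-avail-r {c} pr = trans (sym (ℕ.m+n∸n≡m _ (deg F₀ r))) (cong₂ _∸_ (length-avail pr r)
    (trans (cong (λ b → ℓ + (if b then 0 else 1)) (isRoot-nothing {F = F₀} isolated)) (ℕ.+-identityʳ ℓ)))

  drop : Coloring n κ → Coloring n κ
  drop c = c [ r ]≔ nothing

  drop-r : (c : Coloring n κ) → lookup (drop c) r ≡ nothing
  drop-r c = lookup∘update r c nothing

  drop-off : (c : Coloring n κ) → ∀ {x} → x ≢ r → lookup (drop c) x ≡ lookup c x
  drop-off c ne = lookup∘update′ ne c nothing

  put : Coloring n κ → Fin κ → Coloring n κ
  put c β = c [ r ]≔ just β

  put-off : (c : Coloring n κ) (β : Fin κ) → ∀ {x} → x ≢ r → lookup (put c β) x ≡ lookup c x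
  put-off c β ne = lookup∘update′ ne c (just β)

  drop-put : {c : Coloring n κ} {β : Fin κ} → lookup c r ≡ nothing → drop (put c β) ≡ c
  drop-put {c} eq = trans ([]≔-idempotent c r) (trans (cong (c [ r ]≔_) (sym eq)) ([]≔-lookup c r))

  put-drop : {c : Coloring n κ} {β : Fin κ} → lookup c r ≡ just β → put (drop c) β ≡ c
  put-drop {c} eq = trans ([]≔-idempotent c r) (trans (cong (c [ r ]≔_) (sym eq)) ([]≔-lookup c r))

  restrict : {c : Coloring n κ} → Proper F₁ c → Proper F₀ (drop c)
  restrict {c} pr = record
    { root = rt
    ; edge = λ e → let (d , eq) = edge pr (lift e) in d , trans (drop-off c (≢r e)) eq
    ; sibling = λ e e′ eq → sibling pr (lift e) (lift e′) (trans (sym (drop-off c (≢r e))) (trans eq (drop-off c (≢r e′))))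
    ; parent = par }
    where
    rt : ∀ {x} → lookup F₀ x ≡ nothing → lookup (drop c) x ≡ nothing
    rt {x} e with x ≟F r
    ... | yes refl = drop-r c
    ... | no ne    = trans (drop-off c ne) (root pr (trans (off-r ne) e))
    par : ∀ {x y} → lookup F₀ x ≡ just y → lookup (drop c) x ≢ lookup (drop c) y
    par {x} {y} e eq with y ≟F r
    ... | yes refl = just≢nothing (trans (drop-off c (≢r e)) (proj₂ (edge pr (lift e)))) (trans eq (drop-r c))
    ... | no ne    = parent pr (lift e) (trans (sym (drop-off c (≢r e))) (trans eq (drop-off c ne)))

  extend : {c : Coloring n κ} {β : Fin κ} → Proper F₀ c → β ∈ avail F₀ c p →
    (∀ {x} → lookup F₀ x ≡ just r → lookup c x ≢ just β) → Proper F₁ (put c β)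
  extend {c} {β} pr β∈ none = record { root = rt ; edge = ed ; sibling = sib ; parent = par }
    where
    free : just β ∉ usedAt F₀ c p
    free = Equivalence.to (∈-unused (usedAt F₀ c p)) β∈
    at : lookup (put c β) r ≡ just β
    at = lookup∘update r c (just β)
    rt : ∀ {x} → lookup F₁ x ≡ nothing → lookup (put c β) x ≡ nothing
    rt {x} e with x ≟F r
    ... | yes refl = ⊥-elim (just≢nothing at-r e)
    ... | no ne    = trans (put-off c β ne) (root pr (trans (sym (off-r ne)) e))
    ed : ∀ {x y} → lookup F₁ x ≡ just y → ∃[ d ] lookup (put c β) x ≡ just d
    ed {x} e with x ≟F r
    ... | yes refl = β , at
    ... | no ne    = let (d , eq) = edge pr (lower ne e) in d , trans (put-off c β ne) eq
    sib : ∀ {x x′ y} → lookup F₁ x ≡ just y → lookup F₁ x′ ≡ just y → lookup (put c β) x ≡ lookup (put c β) x′ → x ≡ x′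
    sib {x} {x′} e e′ eq with x ≟F r | x′ ≟F r
    ... | yes refl | yes refl = refl
    ... | yes refl | no ne with refl ← trans (sym at-r) e =
      ⊥-elim (free (∈-usedAt⁺ʳ {F = F₀} {c} (lower ne e′) (trans (sym (put-off c β ne)) (trans (sym eq) at))))
    ... | no ne | yes refl with refl ← trans (sym at-r) e′ =
      ⊥-elim (free (∈-usedAt⁺ʳ {F = F₀} {c} (lower ne e) (trans (sym (put-off c β ne)) (trans eq at))))
    ... | no ne | no ne′ = sibling pr (lower ne e) (lower ne′ e′) (trans (sym (put-off c β ne)) (trans eq (put-off c β ne′)))
    par : ∀ {x y} → lookup F₁ x ≡ just y → lookup (put c β) x ≢ lookup (put c β) y
    par {x} {y} e eq with x ≟F r | y ≟F r
    ... | yes refl | yes refl = p≢r (just-injective (trans (sym at-r) e))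
    ... | no ne | yes refl = none (lower ne e) (trans (sym (put-off c β ne)) (trans eq at))
    ... | no ne | no ne′   = parent pr (lower ne e) (trans (sym (put-off c β ne)) (trans eq (put-off c β ne′)))
    ... | yes refl | no ne with refl ← trans (sym at-r) e = p-coloured (lookup F₀ p) refl
      where
      cp : lookup c p ≡ just β
      cp = trans (sym (put-off c β ne)) (trans (sym eq) at)
      p-coloured : ∀ m → lookup F₀ p ≡ m → _
      p-coloured nothing  ep = just≢nothing cp (root pr ep)
      p-coloured (just q) ep = free (∈-usedAt⁺ˡ {F = F₀} {c} ep cp)

  avail-drop : {c : Coloring n κ} {β : Fin κ} → Proper F₁ c → lookup c r ≡ just β → β ∈ avail F₀ (drop c) p
  avail-drop {c} {β} pr eq = Equivalence.from (∈-unused (usedAt F₀ (drop c) p)) λ m → clash (∈-usedAt⁻ {F = F₀} {drop c} m)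
    where
    clash : _ → _
    clash (inj₁ (_ , _ , cp)) = parent pr at-r (trans eq (sym (trans (sym (drop-off c p≢r)) cp)))
    clash (inj₂ (w , ew , cw)) = ≢r ew (sibling pr (lift ew) at-r (trans (trans (sym (drop-off c (≢r ew))) cw) (sym eq)))

  module _ {w : Fin n} (ew : lookup F₀ w ≡ just r) where
    r<w : rank rk r < rank rk w
    r<w = rank-par rk (lift ew)

    module _ {α β : Fin κ} {c d : Coloring n κ} (K : Kempe F₀ w α β c d) where
      r-off : S K r ≡ false
      r-off = Kempe-rank K rk₀ r<w

      p-off : S K p ≡ false
      p-off = Kempe-rank K rk₀ (ℕ.<-trans p<r r<w)

      -- The path starts below `r`, so no edge at `p` is recoloured.
      avail-Kempe : ∀ {γ} → γ ∈ avail F₀ c p → γ ∈ avail F₀ d p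
      avail-Kempe {γ} m = Equivalence.from (∈-unused (usedAt F₀ d p)) λ u →
        Equivalence.to (∈-unused (usedAt F₀ c p)) m (back (∈-usedAt⁻ {F = F₀} {d} u))
        where
        back : _ → just γ ∈ usedAt F₀ c p
        back (inj₁ (_ , ep , dp)) = ∈-usedAt⁺ˡ {F = F₀} {c} ep (trans (sym (Kempe-off K p-off)) dp)
        back (inj₂ (x , ex , dx)) = ∈-usedAt⁺ʳ {F = F₀} {c} ex (trans (sym (Kempe-child-off K
          (λ { refl → p≢r (just-injective (trans (sym ex) ew)) }) ex p-off)) dx)

  -- The two forests have different children only at `p`, and a recursion that starts below `p`
  -- never visits it. Insertion and deletion can thus both be analysed in `F₀`.
  fixForbidden-≡ : ∀ k {v} {α β : Fin κ} {c} → rank rk p < rank rk v → fixForbidden k F₁ v α β c ≡ fixForbidden k F₀ v α β c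
  fixForbidden-≡ zero lt = refl
  fixForbidden-≡ (suc k) {v} {α} {β} {c} lt
    with childWithColor F₁ c v β | childWithColor F₀ c v β in e
       | cong (λ ch → head (filterᵇ (hasColor c β) ch)) (children-≡ {v} (λ { refl → ℕ.<-irrefl refl lt }))
  ... | nothing | _ | refl = refl
  ... | just w  | _ | refl = fixForbidden-≡ k (ℕ.<-trans lt (rank-par rk₀ (proj₁ (childWithColor-just {F = F₀} {c} {v} {w} {β} e))))

  -- Once the edge of colour `β` above `r` is gone, `β` is free at `r`, so the exchange from `w`
  -- stays proper.
  recolor-del : {c : Coloring n κ} {β : Fin κ} {w : Fin n} → Proper F₁ c → lookup c r ≡ just β → lookup F₀ w ≡ just r →
    ∃[ d ] ∃[ α ] recolor F₀ β (drop c) w (lookup (drop c) w) ≡ return d × lookup c w ≡ just α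
      × Kempe F₀ w α β (drop c) d × Proper F₀ d
  recolor-del {c} {β} {w} pr cr ew with edge pr (lift ew)
  ... | (α , cw) with fixForbidden-Kempe rk₀ n {w} {α} {β} {drop c} (ℕ.m≤n+m n _)
          (λ { refl → parent pr (lift ew) (trans cw (sym cr)) }) (trans (drop-off c (≢r ew)) cw)
          (λ _ → sibling (restrict pr)) (λ _ → parent (restrict pr))
  ...   | (d , eq , K) = d , α , trans (cong (recolor F₀ β (drop c) w) (trans (drop-off c (≢r ew)) cw)) eq , cw , K ,
    Kempe-proper K rk₀ (restrict pr) ew (trans (drop-off c (≢r ew)) cw)
      (λ q → just≢nothing q (drop-r c))
      (λ ex q → parent pr (lift ex) (trans (trans (sym (drop-off c (≢r ex))) q) (sym cr)))

  avail-free : ∀ {F : Forest n} {c : Coloring n κ} {x α} → α ∈ avail F c x → just α ∉ usedAt F c x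
  avail-free {F} {c} {x} = Equivalence.to (∈-unused (usedAt F c x))

  avail-put : ∀ {c : Coloring n κ} {α β} → α ∈ avail F₁ (put c β) r → β ≢ α
  avail-put {c} {α} {β} α∈ refl =
    avail-free {F₁} {put c β} α∈ (∈-usedAt⁺ˡ {F = F₁} {put c β} at-r (lookup∘update r c (just β)))

  -- The exchange gives `w` the colour `α`, which was free at `r`, and thereby removes `β` from the
  -- children of `r`. The edge above `r` can then keep `β`, which is still free at `p`.
  recolor-ins : {c : Coloring n κ} {α β : Fin κ} {w : Fin n} → Proper F₀ c → β ∈ avail F₀ c p →
    lookup F₀ w ≡ just r → lookup c w ≡ just β → α ∈ avail F₁ (put c β) r →
    ∃[ d ] fixForbidden n F₁ w β α (put c β [ w ]≔ just α) ≡ return d × Kempe F₀ w β α c (drop d)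
      × lookup d r ≡ just β × lookup d w ≡ just α × Proper F₁ d
  recolor-ins {c} {α} {β} {w} pr β∈ ew cw α∈
    -- `put c β` is not proper, since `w` and `r` share the colour `β`. Only vertices from the rank
    -- of `w` downwards are inspected, and `r` ranks above them in the tree.
    with fixForbidden-Kempe rk₀ n {w} {β} {α} {put c β} (ℕ.m≤n+m n _) (avail-put {c} α∈)
           (trans (put-off c β (≢r ew)) cw)
           (λ _ e e′ eq → sibling pr e e′ (trans (sym (put-off c β (≢r e))) (trans eq (put-off c β (≢r e′)))))
           (λ {x} {y} le e eq → parent pr e (trans (sym (put-off c β (≢r e))) (trans eq (put-off c β (λ { refl → ℕ.<-irrefl refl (ℕ.<-≤-trans (r<w ew) le) })))))
  ... | (d , eq , K) = d , trans (fixForbidden-≡ n (ℕ.<-trans p<r (r<w ew))) eq , K′ , dr , dw ,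
      subst (Proper F₁) (put-drop dr) (extend pr′ (avail-Kempe ew K′ β∈) none)
    where
    unfree : ∀ {x} → lookup F₀ x ≡ just r → lookup c x ≢ just α
    unfree ex q = avail-free {F₁} {put c β} α∈ (∈-usedAt⁺ʳ {F = F₁} {put c β} (lift ex) (trans (put-off c β (≢r ex)) q))
    K′ : Kempe F₀ w β α c (drop d)
    K′ = subst (λ z → Kempe F₀ w β α z (drop d)) (drop-put (root pr isolated)) (Kempe-frame K nothing isolated (≢-sym (≢r ew)))
    dr : lookup d r ≡ just β
    dr = trans (Kempe-off K (r-off ew K)) (lookup∘update r c (just β))
    dw : lookup d w ≡ just α
    dw = Kempe-start K (trans (put-off c β (≢r ew)) cw)
    pr′ : Proper F₀ (drop d)
    pr′ = Kempe-proper K′ rk₀ pr ew cw (λ q → just≢nothing q (root pr isolated)) unfree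
    none : ∀ {x} → lookup F₀ x ≡ just r → lookup (drop d) x ≢ just β
    none {x} ex q with x ≟F w
    ... | yes refl = avail-put {c} α∈ (just-injective (trans (sym q) (trans (drop-off d (≢r ew)) dw)))
    ... | no ne    = ne (sibling pr ex ew (trans (trans (sym (Kempe-child-off K′ ne ex (r-off ew K′))) q) (sym cw)))

  -- c and c′ are connected by an insertion and, read backwards, by a deletion.
  data Rel (c c′ : Coloring n κ) : Set where
    unchanged : drop c′ ≡ c → Rel c c′
    exchanged : ∀ {w α β} → lookup F₀ w ≡ just r → lookup c′ r ≡ just β → lookup c′ w ≡ just α →
      Kempe F₀ w α β (drop c′) c → Rel c c′

  -- Transition probabilities of the two updates

  insert delete : Coloring n κ → Dist (Coloring n κ)
  insert = step F₀ (ins p r)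
  delete = step F₁ (del p r)

  tail : Coloring n κ → Fin κ → Dist (Coloring n κ)
  tail c β = insTail F₁ r β (put c β) (childWithColor F₁ (put c β) r β)

  conflict : ∀ {c : Coloring n κ} {β w} → childWithColor F₁ (put c β) r β ≡ just w → lookup F₀ w ≡ just r × lookup c w ≡ just β
  conflict {c} {β} {w} e =
    let (ew , cw) = childWithColor-just {F = F₁} {put c β} {r} {w} {β} e
        ne : w ≢ r
        ne = λ { refl → p≢r (just-injective (trans (sym at-r) ew)) }
    in lower ne ew , trans (sym (put-off c β ne)) cw

  no-conflict : ∀ {c : Coloring n κ} {β w} → childWithColor F₁ (put c β) r β ≡ nothing → lookup F₀ w ≡ just r → lookup c w ≢ just β
  no-conflict {c} {β} {w} e ew cw =
    childWithColor-nothing {F = F₁} {put c β} {r} {w} {β} e (lift ew) (trans (put-off c β (≢r ew)) cw)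

  -- The colour of the new edge is already taken at `r` by the child `w`, so the edge blocks no
  -- further colour. Hence there are `b` choices for the replacement colour, not one fewer.
  avail-conflict : ∀ {c : Coloring n κ} {β w} → lookup F₀ w ≡ just r → lookup c w ≡ just β →
    avail F₁ (put c β) r ≡ avail F₀ c r
  avail-conflict {c} {β} {w} ew cw = unused-cong {us = usedAt F₁ (put c β) r} {usedAt F₀ c r} (mk⇔
    (to ∘ ∈-usedAt⁻ {F = F₁} {put c β}) (from ∘ ∈-usedAt⁻ {F = F₀} {c}))
    where
    to : ∀ {γ} → _ ⊎ _ → just γ ∈ usedAt F₀ c r
    to {γ} (inj₁ (_ , _ , q)) = ∈-usedAt⁺ʳ {F = F₀} {c} ew (trans cw (trans (sym (lookup∘update r c (just β))) q))
    to (inj₂ (x , ex , q)) = ∈-usedAt⁺ʳ {F = F₀} {c} (lower ne ex) (trans (sym (put-off c β ne)) q)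
      where
      ne : x ≢ r
      ne refl = p≢r (just-injective (trans (sym at-r) ex))
    from : ∀ {γ} → _ ⊎ _ → just γ ∈ usedAt F₁ (put c β) r
    from (inj₁ (_ , er , _)) = ⊥-elim (just≢nothing er isolated)
    from (inj₂ (x , ex , q)) = ∈-usedAt⁺ʳ {F = F₁} {put c β} (lift ex) (trans (put-off c β (≢r ex)) q)

  tail-supp : ∀ {c c′ : Coloring n κ} {β} → Proper F₀ c → β ∈ avail F₀ c p → c′ ∈ supp (tail c β) →
    lookup c′ r ≡ just β × Proper F₁ c′ × Rel c c′
  tail-supp {c} {c′} {β} pr β∈ m with childWithColor F₁ (put c β) r β in e
  ... | nothing with refl ← ∈-return⁻ refl m =
    lookup∘update r c (just β) , extend pr β∈ (no-conflict {c} e) , unchanged (drop-put (root pr isolated))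
  ... | just w with conflict {c} e | ∈-bind⁻ (uniform (avail F₁ (put c β) r)) _ m
  ...   | (ew , cw) | (α , mα , m′) with recolor-ins pr β∈ ew cw (∈-uniform⁻ mα)
  ...     | (d , eq , K , dr , dw , prd) with refl ← ∈-return⁻ eq m′ =
    dr , prd , exchanged ew dr dw (Kempe-flip (Kempe-sym K))

  insert-supp : ∀ {c c′ : Coloring n κ} → Proper F₀ c → c′ ∈ supp (insert c) → Proper F₁ c′ × Rel c c′
  insert-supp {c} pr m =
    let (β , mβ , m′) = ∈-bind⁻ (uniform (avail F₀ c p)) (tail c) (subst (λ d → _ ∈ supp d) (step-ins F₀ p r c) m)
    in proj₂ (tail-supp pr (∈-uniform⁻ mβ) m′)

  avail-p>0 : ∀ {c : Coloring n κ} → Proper F₀ c → 0 < length (avail F₀ c p)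
  avail-p>0 pr = subst (0 <_) (sym (length-avail-p pr)) a>0

  length-avail-conflict : ∀ {c : Coloring n κ} {β w} → Proper F₀ c → lookup F₀ w ≡ just r → lookup c w ≡ just β →
    length (avail F₁ (put c β) r) ≡ b
  length-avail-conflict {c} pr ew cw = trans (cong length (avail-conflict {c} ew cw)) (length-avail-r pr)

  insert-mass : ∀ {c : Coloring n κ} → Proper F₀ c → mass (insert c) ≡ 1ℚ
  insert-mass {c} pr = trans (cong mass (step-ins F₀ p r c))
    (mass-bind (uniform (avail F₀ c p)) (tail c) (mass-uniform (avail F₀ c p) (avail-p>0 pr)) (λ mβ → tail-mass (∈-uniform⁻ mβ)))
    where
    tail-mass : ∀ {β} → β ∈ avail F₀ c p → mass (tail c β) ≡ 1ℚ
    tail-mass {β} β∈ with childWithColor F₁ (put c β) r β in e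
    ... | nothing = E-return (put c β) _
    ... | just w with conflict {c} e
    ...   | (ew , cw) = mass-bind (uniform (avail F₁ (put c β) r)) _
      (mass-uniform (avail F₁ (put c β) r) (subst (0 <_) (sym (length-avail-conflict pr ew cw)) b>0))
      (λ mα → let (d , eq , _) = recolor-ins pr β∈ ew cw (∈-uniform⁻ mα) in trans (cong mass eq) (E-return d _))

  module _ {c : Coloring n κ} {β : Fin κ} (pr : Proper F₁ c) (cr : lookup c r ≡ just β) where

    recolored : Fin n → Dist (Coloring n κ)
    recolored w = recolor F₀ β (drop c) w (lookup (drop c) w)

    delete-≡ : delete c ≡ (drop c , frac b κ) ∷ concatMap (λ w → scale (frac 1 κ) (recolored w)) (children F₀ r)
    delete-≡ = trans (step-del F₁ p r cr) (cong (λ F → (drop c , frac (κ ∸ length (children F r)) κ)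
      ∷ concatMap (λ w → scale (frac 1 κ) (recolor F β (drop c) w (lookup (drop c) w))) (children F r)) restore)

    E-delete : ∀ g → E (delete c) g ≡ frac b κ * g (drop c) +ℚ frac 1 κ * sumOf (children F₀ r) (λ w → E (recolored w) g)
    E-delete g = trans (cong (λ d → E d g) delete-≡) (cong (frac b κ * g (drop c) +ℚ_) (trans
      (sum-concatMap _ (children F₀ r) _)
      (trans (sum-cong (children F₀ r) (λ {w} _ → E-scale (frac 1 κ) (recolored w) g)) (sum-*ˡ (frac 1 κ) (children F₀ r) _))))

    -- Stopping has weight b/κ and each of the `ℓ` children has weight 1/κ, where b + ℓ = κ.
    delete-mass : mass (delete c) ≡ 1ℚ
    delete-mass = begin
      mass (delete c)
        ≡⟨ E-delete _ ⟩
      frac b κ * 1ℚ +ℚ frac 1 κ * sumOf (children F₀ r) (λ w → mass (recolored w))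
        ≡⟨ cong (λ z → frac b κ * 1ℚ +ℚ frac 1 κ * z) (trans (sum-cong (children F₀ r) one) (sum-1 (children F₀ r))) ⟩
      frac b κ * 1ℚ +ℚ frac 1 κ * ι ℓ
        ≡⟨ cong (λ z → z * 1ℚ +ℚ frac 1 κ * ι ℓ) (frac-split b κ) ⟩
      ι b * frac 1 κ * 1ℚ +ℚ frac 1 κ * ι ℓ
        ≡⟨ solve 3 (λ x y z → x :* y :* con 1ℚ :+ y :* z := (x :+ z) :* y) refl (ι b) (frac 1 κ) (ι ℓ) ⟩
      (ι b +ℚ ι ℓ) * frac 1 κ
        ≡⟨ cong (_* frac 1 κ) (trans (sym (ι-+ b ℓ)) (cong ι (ℕ.m∸n+n≡m (ℕ.<⇒≤ ℓ<κ)))) ⟩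
      ι κ * frac 1 κ
        ≡⟨ ι-frac (ℕ.≤-<-trans z≤n ℓ<κ) ⟩
      1ℚ ∎
      where
      open +-*-Solver
      one : ∀ {w} → w ∈ children F₀ r → mass (recolored w) ≡ 1ℚ
      one m = let (d , _ , eq , _) = recolor-del pr cr (∈-children⁻ F₀ m) in trans (cong mass eq) (E-return d _)

    delete-supp : ∀ {d} → d ∈ supp (delete c) → Proper F₀ d × Rel d c
    delete-supp m with subst (λ z → _ ∈ supp z) delete-≡ m
    ... | here refl = restrict pr , unchanged refl
    ... | there m′ with find (∈-concatMap⁻ (λ w → supp (scale (frac 1 κ) (recolored w))) {xs = children F₀ r}
                          (subst (_ ∈_) (map-concatMap proj₁ _ (children F₀ r)) m′))
    ...   | (w , mw , md) with recolor-del pr cr (∈-children⁻ F₀ mw)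
    ...     | (d , α , eq , cw , K , prd) with refl ← ∈-return⁻ eq (subst (_ ∈_) (supp-scale (frac 1 κ) (recolored w)) md) =
      prd , exchanged (∈-children⁻ F₀ mw) cr cw K

  E-insert : ∀ {c : Coloring n κ} → Proper F₀ c → ∀ g → E (insert c) g ≡ frac 1 a * sumOf (avail F₀ c p) (λ β → E (tail c β) g)
  E-insert {c} pr g = trans (cong (λ d → E d g) (step-ins F₀ p r c)) (trans (E-bind (uniform (avail F₀ c p)) (tail c) g)
    (trans (E-uniform (avail F₀ c p) _) (cong (λ z → frac 1 z * sumOf (avail F₀ c p) (λ β → E (tail c β) g)) (length-avail-p pr))))

  avail-unique : (F : Forest n) (c : Coloring n κ) (x : Fin n) → Unique (avail F c x)
  avail-unique F c x = UP.filter⁺ (T? ∘ isUnused (usedAt F c x)) (UP.allFin⁺ κ)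

  -- The colour of `r` in the result reveals which colour was drawn at `p`, so one summand survives.
  insert-at : ∀ {c c′ : Coloring n κ} {β} → Proper F₀ c → lookup c′ r ≡ just β → β ∈ avail F₀ c p →
    E (insert c) (δ _≟C_ c′) ≡ frac 1 a * E (tail c β) (δ _≟C_ c′)
  insert-at {c} {c′} pr cr β∈ = trans (E-insert pr _) (cong (frac 1 a *_)
    (sum-single (avail-unique F₀ c p) β∈ (λ β → E (tail c β) (δ _≟C_ c′)) (λ {β′} m ne → E-δ-zero _≟C_ (tail c β′) (λ mc →
      ne (just-injective (trans (sym (proj₁ (tail-supp pr m mc))) cr))))))

  module _ {c c′ : Coloring n κ} (pr : Proper F₀ c) (pr′ : Proper F₁ c′) where

    private
      β : Fin κ
      β = proj₁ (edge pr′ at-r)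
      cr : lookup c′ r ≡ just β
      cr = proj₂ (edge pr′ at-r)

    insert-unchanged : drop c′ ≡ c → E (insert c) (δ _≟C_ c′) ≡ frac 1 a
    insert-unchanged refl = trans (insert-at pr cr (avail-drop pr′ cr)) (trans (cong (frac 1 a *_) stay) (ℚ.*-identityʳ _))
      where
      -- In the proper colouring `c′` no child of `r` has the colour of `r`, so the insertion meets
      -- no conflict.
      stay : E (tail (drop c′) β) (δ _≟C_ c′) ≡ 1ℚ
      stay with childWithColor F₁ (put (drop c′) β) r β in e
      ... | nothing = E-δ-hit _≟C_ c′ refl (put-drop {c′} cr)
      ... | just w with conflict {drop c′} e
      ...   | (ew , cw) = ⊥-elim (parent pr′ (lift ew) (trans (trans (sym (drop-off c′ (≢r ew))) cw) (sym cr)))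

    delete-unchanged : drop c′ ≡ c → E (delete c′) (δ _≟C_ c) ≡ frac b κ
    delete-unchanged refl = trans (E-delete pr′ cr _) (trans
      (cong₂ (λ y z → frac b κ * y +ℚ frac 1 κ * z) (δ-≡ _≟C_ {drop c′} refl) (sum-zero (children F₀ r) moved))
      (trans (cong₂ _+ℚ_ (ℚ.*-identityʳ (frac b κ)) (ℚ.*-zeroʳ (frac 1 κ))) (ℚ.+-identityʳ (frac b κ))))
      where
      -- Recolouring via `w` gives `w` the colour `β` of the deleted edge, which `w` does not have
      -- in `c′`; such an outcome is never `drop c′`.
      moved : ∀ {w} → w ∈ children F₀ r → E (recolored pr′ cr w) (δ _≟C_ (drop c′)) ≡ 0ℚ
      moved {w} m =
        let ew = ∈-children⁻ F₀ m
            (d , α , eq , cw , K , _) = recolor-del pr′ cr ew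
        in E-δ-miss _≟C_ (drop c′) eq (λ q → parent pr′ (lift ew)
             (trans (sym (drop-off c′ (≢r ew))) (trans (cong (λ z → lookup z w) (sym q))
               (trans (Kempe-start K (trans (drop-off c′ (≢r ew)) cw)) (sym cr)))))

    module _ {w : Fin n} {α : Fin κ} (ew : lookup F₀ w ≡ just r) (cw : lookup c′ w ≡ just α)
      (K : Kempe F₀ w α β (drop c′) c) where

      private
        c-w : lookup c w ≡ just β
        c-w = Kempe-start K (trans (drop-off c′ (≢r ew)) cw)
        α≢β : α ≢ β
        α≢β eq = parent pr′ (lift ew) (trans cw (trans (cong just eq) (sym cr)))
        K⁻ : Kempe F₀ w β α c (drop c′)
        K⁻ = Kempe-flip (Kempe-sym K)

      α∈ : α ∈ avail F₁ (put c β) r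
      α∈ = subst (α ∈_) (sym (avail-conflict {c} ew c-w))
        (Equivalence.from (∈-unused (usedAt F₀ c r)) (clash ∘ ∈-usedAt⁻ {F = F₀} {c}))
        where
        clash : _ ⊎ _ → _
        clash (inj₁ (_ , er , _)) = just≢nothing er isolated
        clash (inj₂ (x , ex , q)) with x ≟F w
        ... | yes refl = α≢β (just-injective (trans (sym q) c-w))
        ... | no ne    = ne (sibling pr′ (lift ex) (lift ew) (trans (sym (drop-off c′ (≢r ex)))
          (trans (Kempe-child-off K⁻ ne ex (r-off ew K⁻)) (trans q (sym cw)))))

      -- Every choice is forced by `c′`: `β` is the colour of `r`, `w` is the only child of `r`
      -- coloured `β` in `c`, and the replacement must be the colour of `w` in `c′`. The two draws
      -- have probabilities 1/a and 1/b.
      insert-exchanged : E (insert c) (δ _≟C_ c′) ≡ frac 1 a * frac 1 b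
      insert-exchanged = trans (insert-at pr cr β∈) (cong (frac 1 a *_) hit)
        where
        β∈ : β ∈ avail F₀ c p
        β∈ = avail-Kempe ew K (avail-drop pr′ cr)
        hit : E (tail c β) (δ _≟C_ c′) ≡ frac 1 b
        hit with childWithColor F₁ (put c β) r β in e
        ... | nothing = ⊥-elim (no-conflict {c} e ew c-w)
        ... | just w′ with conflict {c} e
        ...   | (ew′ , c-w′) with refl ← sibling pr ew ew′ (trans c-w (sym c-w′)) = begin
          E (uniform (avail F₁ (put c β) r) >>= next) (δ _≟C_ c′)
            ≡⟨ trans (E-bind (uniform (avail F₁ (put c β) r)) next _) (E-uniform (avail F₁ (put c β) r) _) ⟩
          frac 1 (length (avail F₁ (put c β) r)) * sumOf (avail F₁ (put c β) r) (λ γ → E (next γ) (δ _≟C_ c′))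
            ≡⟨ cong₂ (λ y z → frac 1 y * z) (length-avail-conflict pr ew c-w)
                 (sum-single (avail-unique F₁ (put c β) r) α∈ (λ γ → E (next γ) (δ _≟C_ c′)) miss) ⟩
          frac 1 b * E (next α) (δ _≟C_ c′)
            ≡⟨ trans (cong (frac 1 b *_) reach) (ℚ.*-identityʳ (frac 1 b)) ⟩
          frac 1 b ∎
          where
          next : Fin κ → Dist (Coloring n κ)
          next γ = fixForbidden n F₁ w β γ (put c β [ w ]≔ just γ)
          miss : ∀ {γ} → γ ∈ avail F₁ (put c β) r → γ ≢ α → E (next γ) (δ _≟C_ c′) ≡ 0ℚ
          miss {γ} mγ ne = let (d , eq , _ , _ , dw , _) = recolor-ins pr β∈ ew c-w mγ in
            E-δ-miss _≟C_ c′ eq (λ q → ne (just-injective (trans (sym dw) (trans (cong (λ z → lookup z w) q) cw))))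
          reach : E (next α) (δ _≟C_ c′) ≡ 1ℚ
          reach = let (d , eq , Kd , dr , _ , _) = recolor-ins pr β∈ ew c-w α∈ in
            E-δ-hit _≟C_ c′ eq (trans (sym (put-drop dr)) (trans (cong (λ z → put z β) (Kempe-functional rk₀ Kd K⁻)) (put-drop cr)))

      -- The chosen child ends up with colour `β`, and in `c` only `w` has it among the children of
      -- `r`. So one child contributes, and stopping does not.
      delete-exchanged : E (delete c′) (δ _≟C_ c) ≡ frac 1 κ
      delete-exchanged = trans (E-delete pr′ cr _) (trans
        (cong₂ (λ y z → frac b κ * y +ℚ frac 1 κ * z) (δ-≢ _≟C_ {c} moved)
          (trans (sum-single (children-unique F₀ r) (∈-children⁺ F₀ ew) (λ v → E (recolored pr′ cr v) (δ _≟C_ c)) miss) reach))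
        (trans (cong₂ _+ℚ_ (ℚ.*-zeroʳ (frac b κ)) (ℚ.*-identityʳ (frac 1 κ))) (ℚ.+-identityˡ (frac 1 κ))))
        where
        moved : drop c′ ≢ c
        moved q = α≢β (just-injective (trans (sym (trans (drop-off c′ (≢r ew)) cw)) (trans (cong (λ z → lookup z w) q) c-w)))
        miss : ∀ {v} → v ∈ children F₀ r → v ≢ w → E (recolored pr′ cr v) (δ _≟C_ c) ≡ 0ℚ
        miss {v} m ne =
          let ev = ∈-children⁻ F₀ m
              (d , γ , eq , cv , Kd , _) = recolor-del pr′ cr ev
          in E-δ-miss _≟C_ c eq (λ q → ne (sibling pr ev ew
               (trans (cong (λ z → lookup z v) (sym q)) (trans (Kempe-start Kd (trans (drop-off c′ (≢r ev)) cv)) (sym c-w)))))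
        reach : E (recolored pr′ cr w) (δ _≟C_ c) ≡ 1ℚ
        reach with recolor-del pr′ cr ew
        ... | (d , γ , eq , cw′ , Kd , _) with refl ← just-injective (trans (sym cw) cw′) =
          E-δ-hit _≟C_ c eq (Kempe-functional rk₀ Kd K)

  -- κ/(ab), the common value of 1/a divided by b/κ and of 1/(ab) divided by 1/κ. By `reversal` it
  -- is also the number of proper colourings of `F₀` divided by that of `F₁`.
  ratio ratio⁻¹ : ℚ
  ratio   = ι κ * (frac 1 a * frac 1 b)
  ratio⁻¹ = ι a * ι b * frac 1 κ

  private
    κ>0 : 0 < κ
    κ>0 = ℕ.≤-<-trans z≤n ℓ<κ

  balance-Rel : ∀ {c c′ : Coloring n κ} → Proper F₀ c → Proper F₁ c′ → Rel c c′ →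
    E (insert c) (δ _≟C_ c′) ≡ ratio * E (delete c′) (δ _≟C_ c)
  balance-Rel {c} {c′} pr pr′ (unchanged eq) = begin
    E (insert c) (δ _≟C_ c′)
      ≡⟨ insert-unchanged pr pr′ eq ⟩
    frac 1 a
      ≡⟨ solve 1 (λ x → x := con 1ℚ :* x :* con 1ℚ) refl (frac 1 a) ⟩
    1ℚ * frac 1 a * 1ℚ
      ≡⟨ cong₂ (λ y z → y * frac 1 a * z) (ι-frac κ>0) (ι-frac b>0) ⟨
    ι κ * frac 1 κ * frac 1 a * (ι b * frac 1 b)
      ≡⟨ solve 5 (λ k k⁻ a⁻ x x⁻ → k :* k⁻ :* a⁻ :* (x :* x⁻) := k :* (a⁻ :* x⁻) :* (x :* k⁻)) refl
           (ι κ) (frac 1 κ) (frac 1 a) (ι b) (frac 1 b) ⟩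
    ratio * (ι b * frac 1 κ)
      ≡⟨ cong (ratio *_) (trans (delete-unchanged pr pr′ eq) (frac-split b κ)) ⟨
    ratio * E (delete c′) (δ _≟C_ c) ∎
    where
    open +-*-Solver
  balance-Rel {c} {c′} pr pr′ (exchanged {w} {α} {β} ew cr cw K) with refl ← just-injective (trans (sym cr) (proj₂ (edge pr′ at-r))) = begin
    E (insert c) (δ _≟C_ c′)
      ≡⟨ insert-exchanged pr pr′ ew cw K ⟩
    frac 1 a * frac 1 b
      ≡⟨ ℚ.*-identityˡ _ ⟨
    1ℚ * (frac 1 a * frac 1 b)
      ≡⟨ cong (_* (frac 1 a * frac 1 b)) (ι-frac κ>0) ⟨
    ι κ * frac 1 κ * (frac 1 a * frac 1 b)
      ≡⟨ solve 3 (λ k k⁻ x → k :* k⁻ :* x := k :* x :* k⁻) refl (ι κ) (frac 1 κ) (frac 1 a * frac 1 b) ⟩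
    ratio * frac 1 κ
      ≡⟨ cong (ratio *_) (delete-exchanged pr pr′ ew cw K) ⟨
    ratio * E (delete c′) (δ _≟C_ c) ∎
    where
    open +-*-Solver

  -- If either transition is possible, the pair is related by `Rel` and both probabilities are
  -- known; otherwise both vanish.
  balance : ∀ {c c′ : Coloring n κ} → Proper F₀ c → Proper F₁ c′ →
    E (insert c) (δ _≟C_ c′) ≡ ratio * E (delete c′) (δ _≟C_ c)
  balance {c} {c′} pr pr′ with c′ ∈? supp (insert c) | c ∈? supp (delete c′)
    where open DecMembership (_≟C_ {n} {κ}) using (_∈?_)
  ... | yes m | _      = balance-Rel pr pr′ (proj₂ (insert-supp pr m))
  ... | no _  | yes m  = balance-Rel pr pr′ (proj₂ (delete-supp pr′ (proj₂ (edge pr′ at-r)) m))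
  ... | no m∉ | no m∉′ = trans (E-δ-zero _≟C_ (insert c) m∉)
    (sym (trans (cong (ratio *_) (E-δ-zero _≟C_ (delete c′) m∉′)) (ℚ.*-zeroʳ ratio)))

  balance⁻¹ : ∀ {c c′ : Coloring n κ} → Proper F₀ c → Proper F₁ c′ →
    E (delete c′) (δ _≟C_ c) ≡ ratio⁻¹ * E (insert c) (δ _≟C_ c′)
  balance⁻¹ {c} {c′} pr pr′ = begin
    E (delete c′) (δ _≟C_ c)
      ≡⟨ ℚ.*-identityˡ _ ⟨
    1ℚ * 1ℚ * 1ℚ * E (delete c′) (δ _≟C_ c)
      ≡⟨ cong₂ (λ y z → y * z * 1ℚ * E (delete c′) (δ _≟C_ c)) (ι-frac a>0) (ι-frac b>0) ⟨
    ι a * frac 1 a * (ι b * frac 1 b) * 1ℚ * E (delete c′) (δ _≟C_ c)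
      ≡⟨ cong (λ y → ι a * frac 1 a * (ι b * frac 1 b) * y * E (delete c′) (δ _≟C_ c)) (ι-frac κ>0) ⟨
    ι a * frac 1 a * (ι b * frac 1 b) * (ι κ * frac 1 κ) * E (delete c′) (δ _≟C_ c)
      ≡⟨ solve 7 (λ x x⁻ y y⁻ k k⁻ z → x :* x⁻ :* (y :* y⁻) :* (k :* k⁻) :* z := x :* y :* k⁻ :* (k :* (x⁻ :* y⁻) :* z)) refl
           (ι a) (frac 1 a) (ι b) (frac 1 b) (ι κ) (frac 1 κ) (E (delete c′) (δ _≟C_ c)) ⟩
    ratio⁻¹ * (ratio * E (delete c′) (δ _≟C_ c))
      ≡⟨ cong (ratio⁻¹ *_) (balance pr pr′) ⟨
    ratio⁻¹ * E (insert c) (δ _≟C_ c′) ∎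
    where
    open +-*-Solver

  module _ (deg₀≤ : ∀ v → deg F₀ v ≤ κ) where

    insert-DF : (DF {n} {κ} F₀ >>= insert) ≈ DF F₁
    insert-DF = reversal _≟C_ (proj₂ (DF-flat rk₀ deg₀≤)) (proj₂ (DF-flat rk deg≤)) insert delete ratio
      insert-mass (λ pr m → proj₁ (insert-supp pr m))
      (λ pr → delete-mass pr (proj₂ (edge pr at-r))) (λ pr m → proj₁ (delete-supp pr (proj₂ (edge pr at-r)) m))
      balance

    delete-DF : (DF {n} {κ} F₁ >>= delete) ≈ DF F₀
    delete-DF = reversal _≟C_ (proj₂ (DF-flat rk deg≤)) (proj₂ (DF-flat rk₀ deg₀≤)) delete insert ratio⁻¹
      (λ pr → delete-mass pr (proj₂ (edge pr at-r))) (λ pr m → proj₁ (delete-supp pr (proj₂ (edge pr at-r)) m))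
      insert-mass (λ pr m → proj₁ (insert-supp pr m))
      (λ pr pr′ → balance⁻¹ pr′ pr)

-- The empty forest and the sequence of updates

deg-empty : (v : Fin n) → deg emptyF v ≡ 0
deg-empty {n} v = cong₂ (λ l b → length l + (if b then 0 else 1))
  (none (children emptyF v) (λ {x} m → just≢nothing (∈-children⁻ emptyF m) (lookup-replicate x nothing)))
  (isRoot-nothing {F = emptyF} (lookup-replicate v nothing))
  where
  none : (xs : List (Fin n)) → (∀ {x} → x ∉ xs) → xs ≡ []
  none []       _  = refl
  none (x ∷ xs) x∉ = ⊥-elim (x∉ (here refl))

-- The sampler runs once for every vertex, each being a root, so the two lists need not coincide.
-- But `emptyC` is the only proper colouring, and the mass is 1.
DF-empty : return emptyC ≈ DF {n} {κ} emptyF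
DF-empty {n} {κ} g = sym (point-mass {d = DF {n} {κ} emptyF} (total flat) (λ m → only (Equivalence.to (support flat) m)) g)
  where
  flat : Flat (DF {n} {κ} emptyF) _ (Proper emptyF)
  flat = proj₂ (DF-flat ranked-empty (λ v → subst (_≤ κ) (sym (deg-empty v)) z≤n))
  only : {c : Coloring n κ} → Proper emptyF c → c ≡ emptyC
  only pr = lookup-≗ (λ x → trans (root pr (lookup-replicate x nothing)) (sym (lookup-replicate x nothing)))

step-DF : {F : Forest n} (u : Update n) → Ranked F → (∀ v → deg F v ≤ κ) → Legal F u → (∀ v → deg (applyU F u) v ≤ κ) →
  Ranked (applyU F u) × (DF {n} {κ} F >>= step F u) ≈ DF (applyU F u)
step-DF {F = F} (ins p r) rk deg≤ (isolated , notAnc) deg≤′ = rk′ , Link.insert-DF F p r isolated rk′ deg≤′ deg≤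
  where
  rk′ : Ranked (F [ r ]≔ just p)
  rk′ = ranked-link rk notAnc
-- A deletion is placed in `Link` with the cut forest as base; relinking `r` to `p` gives back `F`
-- only up to a propositional equality, along which the statement is transported.
step-DF {n} {κ} {F} (del p r) rk deg≤ e deg≤′ = ranked-cut rk ,
  subst (λ G → (DF {n} {κ} G >>= step G (del p r)) ≈ DF F₀) F₁≡F
    (Link.delete-DF F₀ p r (lookup∘update r F nothing) (subst Ranked (sym F₁≡F) rk)
      (subst (λ G → ∀ v → deg G v ≤ κ) (sym F₁≡F) deg≤) deg≤′)
  where
  F₀ : Forest n
  F₀ = F [ r ]≔ nothing
  F₁≡F : F₀ [ r ]≔ just p ≡ F
  F₁≡F = trans ([]≔-idempotent F r) (trans (cong (F [ r ]≔_) (sym e)) ([]≔-lookup F r))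

-- Generalised to an arbitrary starting forest and any distribution `≈` to its `DF`, as `runC`
-- passes the current distribution on to the next update.
run-DF : {Δ : ℕ} → Δ ≤ κ → (us : List (Update n)) {F : Forest n} {d : Dist (Coloring n κ)} → Ranked F → (∀ v → deg F v ≤ κ) →
  ValidFrom Δ F us → d ≈ DF F → ∀ t → runC F d (take t us) ≈ DF (runF F (take t us))
run-DF le us       rk deg≤ valid eq zero    = eq
run-DF le []       rk deg≤ valid eq (suc t) = eq
run-DF le (u ∷ us) {F} {d} rk deg≤ (legal , deg≤Δ , valid) eq (suc t) =
  let deg≤′ = λ v → ℕ.≤-trans (deg≤Δ v) le
      (rk′ , eq′) = step-DF u rk deg≤ legal deg≤′
  in run-DF le us rk′ deg≤′ valid (λ g → trans (≈-bind {d = d} {DF F} (step F u) eq g) (eq′ g)) t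

theorem4p3 : (n Δ κ : ℕ) → 2 ≤ Δ → Δ ≤ κ →
    (us : List (Update n)) → ValidFrom Δ emptyF us →
    (t : ℕ) → t ≤ length us →
    (c : Coloring n κ) →
    prob _≟C_ (runC emptyF (return emptyC) (take t us)) c
    ≡ prob _≟C_ (DF (runF emptyF (take t us))) c
theorem4p3 n Δ κ _ Δ≤κ us valid t _ c = ≈⇒prob _≟C_
  {runC emptyF (return emptyC) (take t us)} {DF (runF emptyF (take t us))}
  (run-DF Δ≤κ us ranked-empty (λ v → subst (_≤ κ) (sym (deg-empty v)) z≤n) valid DF-empty t) c
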